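{- Let $a\ge b\ge 2$ be integers. If the spider $S(a,b,2)$ is $e$-positive, then \[a\in\bigcup_{q=1}^{b-2}\{m\in\mathbb N:\ (b+2)q\le m\le (b+1)q+b-2\}.\] Moreover, if $a\equiv 0\pmod 3$ and $b\equiv 1\pmod 3$, then $a\le 2b+4$. -}

module Defs where

open import Data.Bool using (if_then_else_)
open import Data.Empty using (⊥)
open import Data.Fin using (Fin; toℕ) renaming (_≟_ to _≟ᶠ_)
open import Data.Fin.Properties using (all?)
open import Data.List using (List; []; _∷_; _++_; map; foldr; filter; concatMap;
  cartesianProductWith; upTo; allFin; replicate)
open import Data.List.Membership.DecPropositional using () renaming (_∈?_ to mem?)
open import Data.List.Membership.Propositional using (_∈_)
open import Data.List.Relation.Unary.All using (All; []; _∷_)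
import Data.List.Relation.Unary.All as All
open import Data.List.Relation.Unary.All.Properties using (++⁺; map⁺)
open import Data.Nat.ListAction using (sum)
open import Data.Nat using (ℕ; zero; suc; _+_; _∸_; _<_; _/_; z<s; _≟_) renaming (_*_ to _*ℕ_)
open import Data.Nat.Properties using (n<1+n; <-irrefl)
open import Data.Product using (Σ; _×_; _,_)
open import Data.Product.Properties using () renaming (≡-dec to ×-≡-dec)
open import Data.Rational using (ℚ; 0ℚ; 1ℚ; _*_; _≤_) renaming (_+_ to _+ℚ_)
open import Data.Sum using (_⊎_; [_,_]; swap)
open import Data.Vec using (Vec; []; _∷_; lookup; tabulate; count; zipWith)
import Data.Vec as Vec
open import Data.Vec.Properties using () renaming (≡-dec to Vec-≡-dec)
open import Level using (0ℓ)
open import Relation.Binary using (Rel; Decidable; Symmetric; Irreflexive)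
open import Relation.Binary.PropositionalEquality using (_≡_; _≢_; refl)
open import Relation.Nullary using (Dec; does; ¬?)
open import Relation.Nullary.Decidable using (_→-dec_; _⊎-dec_)

∑[_] : {A : Set} → List A → (A → ℚ) → ℚ
∑[ xs ] f = foldr _+ℚ_ 0ℚ (map f xs)

-- The Cartesian product of the given lists.
choices : {A : Set} {n : ℕ} → Vec (List A) n → List (Vec A n)
choices []         = [] ∷ []
choices (xs ∷ xss) = cartesianProductWith _∷_ xs (choices xss)

-- Series in x₁, …, x_N, given by their coefficients: f α is the coefficient
-- of x₁^α₁ ⋯ x_N^α_N.
PowerSeries : ℕ → Set
PowerSeries N = Vec ℕ N → ℚ

infixl 7 _⊛_

_⊛_ : {N : ℕ} → PowerSeries N → PowerSeries N → PowerSeries N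
(f ⊛ g) α = ∑[ choices (Vec.map (λ a → upTo (suc a)) α) ] λ β →
  f β * g (zipWith _∸_ α β)

x^_ : {N : ℕ} → Vec ℕ N → PowerSeries N
(x^ β) α = if does (Vec-≡-dec _≟_ α β) then 1ℚ else 0ℚ

-- A series in countably many variables x₁, x₂, … is represented by its
-- truncations (x_i = 0 for i > N) for all N.  Every monomial involves only
-- finitely many variables, so the truncations determine all coefficients.
Series∞ : Set
Series∞ = (N : ℕ) → PowerSeries N

-- The sum of all squarefree monomials of degree k.
elementary : ℕ → Series∞
elementary k N α =
  ∑[ filter (λ β → Vec.sum β ≟ k) (choices (Vec.replicate N (0 ∷ 1 ∷ []))) ] λ β →
    (x^ β) α

e : List ℕ → Series∞
e parts N = foldr (λ k f → elementary k N ⊛ f) (x^ Vec.replicate N 0) parts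

-- Partitions of n with all parts ≤ m, as weakly decreasing lists of positive
-- numbers; j is the multiplicity of the largest allowed part.
partitionsBounded : (m n : ℕ) → List (List ℕ)
partitionsBounded zero    zero    = [] ∷ []
partitionsBounded zero    (suc _) = []
partitionsBounded (suc m) n       =
  concatMap
    (λ j → map (replicate j (suc m) ++_) (partitionsBounded m (n ∸ j *ℕ suc m)))
    (upTo (suc (n / suc m)))

partitions : ℕ → List (List ℕ)
partitions n = partitionsBounded n n

-- e-positivity of a symmetric function f that is homogeneous of degree n:
-- the coefficients c of its expansion in the basis (e_μ), μ ⊢ n, are
-- nonnegative.
EPositive : ℕ → Series∞ → Set
EPositive n f =
  Σ (List ℕ → ℚ) λ c →
    (∀ μ → μ ∈ partitions n → 0ℚ ≤ c μ) ×
    (∀ N α → f N α ≡ ∑[ partitions n ] λ μ → c μ * e μ N α)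

record Graph : Set₁ where
  field
    order      : ℕ
    Adj        : Rel (Fin order) 0ℓ
    adj?       : Decidable Adj
    adj-sym    : Symmetric Adj
    adj-irrefl : Irreflexive _≡_ Adj

module _ (G : Graph) where
  open Graph G

  Proper : {N : ℕ} → Vec (Fin N) order → Set
  Proper κ = ∀ u v → Adj u v → lookup κ u ≢ lookup κ v

  proper? : {N : ℕ} (κ : Vec (Fin N) order) → Dec (Proper κ)
  proper? κ = all? λ u → all? λ v →
    adj? u v →-dec ¬? (lookup κ u ≟ᶠ lookup κ v)

  -- The exponent vector of the monomial ∏_v x_{κ(v)}.
  content : {N : ℕ} → Vec (Fin N) order → Vec ℕ N
  content κ = tabulate λ i → count (i ≟ᶠ_) κ

  chromaticSymmetricFunction : Series∞
  chromaticSymmetricFunction N α =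
    ∑[ filter proper? (choices (Vec.replicate order (allFin N))) ] λ κ →
      (x^ content κ) α

  IsEPositive : Set
  IsEPositive = EPositive order chromaticSymmetricFunction

-- The edges of a path of length ℓ that starts at the centre 0 and then visits
-- s + 1, s + 2, …, s + ℓ.
legEdges : (s ℓ : ℕ) → List (ℕ × ℕ)
legEdges s zero    = []
legEdges s (suc ℓ) = (0 , suc s) ∷ map (λ i → (suc (s + i) , suc (suc (s + i)))) (upTo ℓ)

-- Legs of the given lengths (numbers of edges), numbered consecutively after s.
spiderEdges : ℕ → List ℕ → List (ℕ × ℕ)
spiderEdges s []         = []
spiderEdges s (ℓ ∷ legs) = legEdges s ℓ ++ spiderEdges (s + ℓ) legs

Increasing : ℕ × ℕ → Set
Increasing (i , j) = i < j

spiderEdges-increasing : ∀ s legs → All Increasing (spiderEdges s legs)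
spiderEdges-increasing s []         = []
spiderEdges-increasing s (ℓ ∷ legs) =
  ++⁺ (leg ℓ) (spiderEdges-increasing (s + ℓ) legs)
  where
  leg : ∀ ℓ → All Increasing (legEdges s ℓ)
  leg zero    = []
  leg (suc ℓ) = z<s ∷ map⁺ (All.universal (λ i → n<1+n (suc (s + i))) (upTo ℓ))

spider : List ℕ → Graph
spider legs = record
  { order      = suc (sum legs)
  ; Adj        = λ u v → Edge u v ⊎ Edge v u
  ; adj?       = λ u v → edge? u v ⊎-dec edge? v u
  ; adj-sym    = swap
  ; adj-irrefl = λ { refl → [ loopless , loopless ] }
  }
  where
  edges = spiderEdges 0 legs

  Edge : Rel (Fin (suc (sum legs))) 0ℓ
  Edge u v = (toℕ u , toℕ v) ∈ edges

  edge? : Decidable Edge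
  edge? u v = mem? (×-≡-dec _≟_ _≟_) (toℕ u , toℕ v) edges

  loopless : ∀ {u} → Edge u u → ⊥
  loopless uu = <-irrefl refl (All.lookup (spiderEdges-increasing 0 legs) uu)

{-# OPTIONS --safe #-}

-- An e-positive symmetric function takes a nonnegative value at any points, in a ring that contains the dual
-- numbers ℚ[ε], at which all e_k are nonnegative dual numbers.  Such points exist for arbitrary prescribed
-- values of e_1, …, e_N: adjoin the roots of Σ e_k z^k one after the other.
--
-- Write X_m for the path with m vertices and n = a + b + 3.  Then
--   X_S(a,b,2) = X_n + X_1 X_{n-1} + X_2 X_{n-2} - X_{a+1} X_{b+2} - X_{a+2} X_{b+1},
-- and Σ X_m z^m = E / (E - z E′) for E = Σ e_k z^k.  If E = 1 + z^{b+1} + z^{b+2}, the spider has the value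
-- -(X_{a+1} + X_{a+2}), which is negative unless X_{a+1} = X_{a+2} = 0; this excludes every n that is a sum of
-- parts b + 1 and b + 2.  If E = 1 + z^3 + ε z^4, a = 3k + 3 and b = 3l + 1, its value is a positive multiple
-- of (18 l + 10 - 9 k) ε.
module Submission where

open import Defs
open import Algebra using (AbelianGroup; CommutativeRing; IsCommutativeRing)
import Algebra.Construct.DirectProduct as DirectProduct
import Algebra.Morphism.Construct.Composition as Composition
import Algebra.Morphism.Construct.Identity as Identity
import Algebra.Morphism.Structures as Morphisms
import Algebra.Properties.Ring
import Algebra.Properties.Semiring.Exp
import Algebra.Properties.Semiring.Mult
import Algebra.Properties.Semiring.Sum
import Algebra.Solver.Ring.NaturalCoefficients.Default as NatSolver
open import Data.Bool using (Bool; true; false; if_then_else_; _∧_)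
open import Data.Fin using (Fin; zero; suc; toℕ; inject₁) renaming (_≟_ to _≟ᶠ_)
open import Data.Fin.Properties using (suc-injective; toℕ-injective)
open import Data.Integer using (+≤+)
open import Data.List using (List; []; _∷_; _++_; map; foldr; filter; concatMap; cartesianProductWith;
  applyUpTo; upTo; allFin; deduplicate)
open import Data.List.Membership.Propositional using (_∈_; _∉_; lose)
open import Data.List.Membership.Propositional.Properties using (∈-allFin; ∈-++⁺ˡ; ∈-++⁺ʳ; ∈-concatMap⁺;
  ∈-deduplicate⁺; ∈-upTo⁺; ∈-upTo⁻)
open import Data.List.Properties using (map-∘; map-tabulate; map-applyUpTo)
open import Data.List.Relation.Unary.All as All using (All; []; _∷_)
open import Data.List.Relation.Unary.Any using (here; there)
open import Data.List.Relation.Unary.AllPairs using ([]; _∷_)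
open import Data.List.Relation.Unary.Unique.DecPropositional.Properties using (deduplicate-!)
open import Data.List.Relation.Unary.Unique.Propositional using (Unique)
open import Data.List.Relation.Unary.Unique.Propositional.Properties using (allFin⁺; upTo⁺)
open import Data.Nat as ℕ using (ℕ; zero; suc; _<_; s≤s; z≤n; _^_; _%_; _/_; _∸_; _≟_)
open import Data.Nat.DivMod using (m≡m%n+[m/n]*n; m%n<n)
open import Data.Nat.Induction using (<-rec)
open import Data.Nat.ListAction using (sum)
import Data.Nat.Properties as ℕ
open import Data.Nat.Solver using (module +-*-Solver)
open import Data.Product using (_×_; _,_; proj₁; proj₂; Σ-syntax; ∃-syntax)
open import Data.Product.Relation.Binary.Pointwise.NonDependent using (Pointwise)
open import Data.Rational using (ℚ; 0ℚ; 1ℚ; *≤*; nonNegative)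
  renaming (_+_ to _+ℚ_; _*_ to _*ℚ_; -_ to -ℚ_; _≤_ to _≤ℚ_)
import Data.Rational.Properties as ℚ
open import Data.Sum using (_⊎_; inj₁; inj₂)
open import Data.Unit using (⊤; tt)
open import Data.Vec using (Vec; []; _∷_; zipWith; lookup; tabulate; count)
import Data.Vec as Vec
open import Data.Vec.Functional using () renaming (_∷_ to _∷ᶠ_)
open import Data.Vec.Properties using (tabulate-cong) renaming (≡-dec to Vec-≡-dec)
open import Function using (_∘_; id; mk⇔; _⇔_; Equivalence)
open import Level using (0ℓ)
open import Relation.Binary using (DecidableEquality)
open import Relation.Binary.PropositionalEquality as ≡ using (_≡_; _≢_)
import Relation.Binary.Reasoning.Setoid as SetoidReasoning
open import Relation.Nullary using (Dec; ¬_; yes; no; does; ¬?; contradiction)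
open import Relation.Nullary.Decidable using (dec-true; dec-false; does-⇔; _×-dec_)
open import Relation.Unary using (Pred; Decidable)

-- The points lie in a ring without any order; only values that are images of dual numbers are ever
-- compared. The choice of E comes from the formula for the spider. If e_1 = e_2 = 0, then X_1 = X_2
-- = 0 and the two positive products disappear. If moreover e_{b+1} = e_{b+2} = 1, then X_{b+1} = b
-- + 1 and X_{b+2} = b + 2, while the denominator E - z E′ = 1 - b z^(b+1) - (b+1) z^(b+2) gives X_n
-- = b X_{a+2} + (b+1) X_{a+1}. This falls short of the two negative products by exactly one copy of
-- X_{a+1} and one of X_{a+2}. Division of a + 2 by b + 1 turns the excluded cases into the gaps
-- between the stated intervals. For the second claim E = 1 + z^3 alone gives no information: n =
-- 3(k + l) + 7 is not divisible by 3, so every e_μ vanishes. The term ε z^4 perturbs this to first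
-- order; only partitions with exactly one part 4 and otherwise parts 3 contribute.

Ring₀ = CommutativeRing 0ℓ 0ℓ
module Ring₀ = CommutativeRing {0ℓ} {0ℓ}

-- Injectivity of `ι` is what allows an equation between values in the large ring to be read as an
-- equation in `A`, where nonnegativity makes sense.
record Extension (A : Ring₀) : Set₁ where
  field
    ring : Ring₀
    ι : Ring₀.Carrier A → Ring₀.Carrier ring
    mono : Morphisms.IsRingMonomorphism (Ring₀.rawRing A) (Ring₀.rawRing ring) ι

-- Splitting a polynomial

module AdjoinRoot (A : Ring₀) (m : ℕ) (a : ℕ → Ring₀.Carrier A) where
  open CommutativeRing A hiding (zero)
  open Algebra.Properties.Semiring.Sum semiring renaming (sum to ∑ᶠ)
  open Algebra.Properties.Ring (Ring₀.ring A)
  open SetoidReasoning setoid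
  open NatSolver commutativeSemiring using (solve; _:+_; _:*_; _:=_)

  Coords : Set
  Coords = Fin (suc m) → Carrier

  infix 4 _≋_
  _≋_ : Coords → Coords → Set
  v ≋ w = ∀ k → v k ≈ w k

  -- Coordinates refer to the basis quotient 0, …, quotient m below, on which root acts by
  -- root · quotient k = a (k + 1) - quotient (k + 1), with quotient (m + 1) = 0.
  times-root : Coords → Coords
  times-root v zero    = ∑ᶠ (λ k → a (suc (toℕ k)) * v k)
  times-root v (suc k) = - v (inject₁ k)

  infixl 6 _⊕_
  infixl 7 _⊗_
  data Expr : Set where
    con     : Carrier → Expr
    root    : Expr
    _⊕_ _⊗_ : Expr → Expr → Expr

  ⟦_⟧ : Expr → Coords → Coords
  ⟦ con c ⟧ v k = c * v k
  ⟦ root  ⟧ v   = times-root v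
  ⟦ p ⊕ q ⟧ v k = ⟦ p ⟧ v k + ⟦ q ⟧ v k
  ⟦ p ⊗ q ⟧ v   = ⟦ p ⟧ (⟦ q ⟧ v)

  ⟦⟧-cong : ∀ p {v w} → v ≋ w → ⟦ p ⟧ v ≋ ⟦ p ⟧ w
  ⟦⟧-cong (con c) v≋w k       = *-congˡ (v≋w k)
  ⟦⟧-cong root    v≋w zero    = sum-cong-≋ (λ k → *-congˡ {a (suc (toℕ k))} (v≋w k))
  ⟦⟧-cong root    v≋w (suc k) = -‿cong (v≋w (inject₁ k))
  ⟦⟧-cong (p ⊕ q) v≋w k       = +-cong (⟦⟧-cong p v≋w k) (⟦⟧-cong q v≋w k)
  ⟦⟧-cong (p ⊗ q) v≋w         = ⟦⟧-cong p (⟦⟧-cong q v≋w)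

  ⟦⟧-+ : ∀ p v w → ⟦ p ⟧ (λ k → v k + w k) ≋ (λ k → ⟦ p ⟧ v k + ⟦ p ⟧ w k)
  ⟦⟧-+ (con c) v w k       = distribˡ c (v k) (w k)
  ⟦⟧-+ root    v w zero    = trans (sum-cong-≋ (λ k → distribˡ (a (suc (toℕ k))) (v k) (w k)))
                                   (∑-distrib-+ (λ k → a (suc (toℕ k)) * v k) (λ k → a (suc (toℕ k)) * w k))
  ⟦⟧-+ root    v w (suc k) = sym (-‿+-comm (v (inject₁ k)) (w (inject₁ k)))
  ⟦⟧-+ (p ⊕ q) v w k       = trans (+-cong (⟦⟧-+ p v w k) (⟦⟧-+ q v w k))
    (solve 4 (λ s t u x → (s :+ t) :+ (u :+ x) := (s :+ u) :+ (t :+ x)) refl _ _ _ _)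
  ⟦⟧-+ (p ⊗ q) v w k       = trans (⟦⟧-cong p (⟦⟧-+ q v w) k) (⟦⟧-+ p (⟦ q ⟧ v) (⟦ q ⟧ w) k)

  ⟦⟧-* : ∀ p c v → ⟦ p ⟧ (λ k → c * v k) ≋ (λ k → c * ⟦ p ⟧ v k)
  ⟦⟧-* (con d) c v k       = solve 3 (λ c d x → d :* (c :* x) := c :* (d :* x)) refl c d (v k)
  ⟦⟧-* root    c v zero    = trans
    (sum-cong-≋ (λ k → solve 3 (λ c d x → d :* (c :* x) := c :* (d :* x)) refl c (a (suc (toℕ k))) (v k)))
    (sym (*-distribˡ-sum c (λ k → a (suc (toℕ k)) * v k)))
  ⟦⟧-* root    c v (suc k) = -‿distribʳ-* c (v (inject₁ k))
  ⟦⟧-* (p ⊕ q) c v k       = trans (+-cong (⟦⟧-* p c v k) (⟦⟧-* q c v k)) (sym (distribˡ c _ _))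
  ⟦⟧-* (p ⊗ q) c v k       = trans (⟦⟧-cong p (⟦⟧-* q c v) k) (⟦⟧-* p c (⟦ q ⟧ v) k)

  root-comm : ∀ p v → times-root (⟦ p ⟧ v) ≋ ⟦ p ⟧ (times-root v)
  root-comm (con c) v   = ⟦⟧-* root c v
  root-comm root    v k = refl
  root-comm (p ⊕ q) v k = trans (⟦⟧-+ root (⟦ p ⟧ v) (⟦ q ⟧ v) k) (+-cong (root-comm p v k) (root-comm q v k))
  root-comm (p ⊗ q) v k = trans (root-comm p (⟦ q ⟧ v) k) (⟦⟧-cong p (root-comm q v) k)

  -- Every expression acts as a polynomial in the single linear operator `times-root`, and such
  -- polynomials commute.
  ⟦⟧-comm : ∀ p q v → ⟦ p ⟧ (⟦ q ⟧ v) ≋ ⟦ q ⟧ (⟦ p ⟧ v)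
  ⟦⟧-comm (con c)   q v k = sym (⟦⟧-* q c v k)
  ⟦⟧-comm root      q v k = root-comm q v k
  ⟦⟧-comm (p ⊕ p′) q v k = trans (+-cong (⟦⟧-comm p q v k) (⟦⟧-comm p′ q v k))
                                   (sym (⟦⟧-+ q (⟦ p ⟧ v) (⟦ p′ ⟧ v) k))
  ⟦⟧-comm (p ⊗ p′) q v k = trans (⟦⟧-cong p (⟦⟧-comm p′ q v) k) (⟦⟧-comm p q (⟦ p′ ⟧ v) k)

  basis : ℕ → ∀ {n} → Fin n → Carrier
  basis zero    zero    = 1#
  basis zero    (suc _) = 0#
  basis (suc j) zero    = 0#
  basis (suc j) (suc k) = basis j k

  -- Expressions act on A^(m+1) by commuting operators, so equality of the images of the single vector
  -- basis 0 is a congruence: this makes Expr the ring A[root].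
  infix 4 _≈ᴱ_
  record _≈ᴱ_ (p q : Expr) : Set where
    constructor ⟪_⟫
    field at : ⟦ p ⟧ (basis 0) ≋ ⟦ q ⟧ (basis 0)
  open _≈ᴱ_

  ⊗-cong : ∀ {p p′ q q′} → p ≈ᴱ p′ → q ≈ᴱ q′ → p ⊗ q ≈ᴱ p′ ⊗ q′
  ⊗-cong {p} {p′} {q} {q′} p≈p′ q≈q′ = ⟪ (λ k → begin
    ⟦ p ⟧ (⟦ q ⟧ (basis 0)) k   ≈⟨ ⟦⟧-cong p (at q≈q′) k ⟩
    ⟦ p ⟧ (⟦ q′ ⟧ (basis 0)) k  ≈⟨ ⟦⟧-comm p q′ (basis 0) k ⟩
    ⟦ q′ ⟧ (⟦ p ⟧ (basis 0)) k  ≈⟨ ⟦⟧-cong q′ (at p≈p′) k ⟩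
    ⟦ q′ ⟧ (⟦ p′ ⟧ (basis 0)) k ≈⟨ ⟦⟧-comm q′ p′ (basis 0) k ⟩
    ⟦ p′ ⟧ (⟦ q′ ⟧ (basis 0)) k ∎) ⟫

  -1*x+x≈0 : ∀ x → - 1# * x + x ≈ 0#
  -1*x+x≈0 x = trans (+-congʳ (-1*x≈-x x)) (-‿inverseˡ x)

  isCommutativeRingᴱ : IsCommutativeRing _≈ᴱ_ _⊕_ _⊗_ (con (- 1#) ⊗_) (con 0#) (con 1#)
  isCommutativeRingᴱ = record
    { isRing = record
      { +-isAbelianGroup = record
        { isGroup = record
          { isMonoid = record
            { isSemigroup = record
              { isMagma = record
                { isEquivalence = record
                  { refl  = ⟪ (λ _ → refl) ⟫
                  ; sym   = λ p → ⟪ (λ k → sym (at p k)) ⟫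
                  ; trans = λ p q → ⟪ (λ k → trans (at p k) (at q k)) ⟫
                  }
                ; ∙-cong = λ p q → ⟪ (λ k → +-cong (at p k) (at q k)) ⟫
                }
              ; assoc = λ _ _ _ → ⟪ (λ _ → +-assoc _ _ _) ⟫
              }
            ; identity = (λ _ → ⟪ (λ _ → trans (+-congʳ (zeroˡ _)) (+-identityˡ _)) ⟫)
                       , (λ _ → ⟪ (λ _ → trans (+-congˡ (zeroˡ _)) (+-identityʳ _)) ⟫)
            }
          ; inverse = (λ _ → ⟪ (λ _ → trans (-1*x+x≈0 _) (sym (zeroˡ _))) ⟫)
                    , (λ _ → ⟪ (λ _ → trans (+-comm _ _) (trans (-1*x+x≈0 _) (sym (zeroˡ _)))) ⟫)
          ; ⁻¹-cong = λ p → ⟪ (λ k → *-congˡ (at p k)) ⟫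
          }
        ; comm = λ _ _ → ⟪ (λ _ → +-comm _ _) ⟫
        }
      ; *-cong = ⊗-cong
      ; *-assoc = λ _ _ _ → ⟪ (λ _ → refl) ⟫
      ; *-identity = (λ _ → ⟪ (λ _ → *-identityˡ _) ⟫)
                   , (λ p → ⟪ (λ k → trans (⟦⟧-* p 1# (basis 0) k) (*-identityˡ _)) ⟫)
      ; distrib = (λ p q r → ⟪ ⟦⟧-+ p (⟦ q ⟧ (basis 0)) (⟦ r ⟧ (basis 0)) ⟫)
                , (λ _ _ _ → ⟪ (λ _ → refl) ⟫)
      }
    ; *-comm = λ p q → ⟪ ⟦⟧-comm p q (basis 0) ⟫
    }

  A[root] : Ring₀
  A[root] = record { isCommutativeRing = isCommutativeRingᴱ }

  con-mono : Morphisms.IsRingMonomorphism (Ring₀.rawRing A) (Ring₀.rawRing A[root]) con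
  con-mono = record
    { isRingHomomorphism = record
      { isSemiringHomomorphism = record
        { isNearSemiringHomomorphism = record
          { +-isMonoidHomomorphism = record
            { isMagmaHomomorphism = record
              { isRelHomomorphism = record { cong = λ c≈d → ⟪ (λ _ → *-congʳ c≈d) ⟫ }
              ; homo = λ _ _ → ⟪ (λ _ → distribʳ _ _ _) ⟫
              }
            ; ε-homo = ⟪ (λ _ → refl) ⟫
            }
          ; *-homo = λ _ _ → ⟪ (λ _ → *-assoc _ _ _) ⟫
          }
        ; 1#-homo = ⟪ (λ _ → refl) ⟫
        }
      ; -‿homo = λ c → ⟪ (λ k → trans (*-congʳ (sym (-1*x≈-x c))) (*-assoc _ _ _)) ⟫
      }
    -- The coordinate `zero` of `basis 0` is 1, so it returns the scalar itself: the action on a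
    -- free module cannot identify two scalars.
    ; injective = λ {c} {d} c≈d → trans (sym (*-identityʳ c)) (trans (at c≈d zero) (*-identityʳ d))
    }

  -- The coefficients of (Σ aₖ zᵏ) / (1 + root z), provided a₀ = 1.
  quotient : ℕ → Expr
  quotient zero    = con 1#
  quotient (suc k) = con (a (suc k)) ⊕ con (- 1#) ⊗ (root ⊗ quotient k)

  sum-basis : ∀ (f : ℕ → Carrier) {n} j → j < n → ∑ᶠ {n} (λ k → f (toℕ k) * basis j k) ≈ f j
  sum-basis f {suc n} zero j<n = begin
    f 0 * 1# + ∑ᶠ {n} (λ k → f (suc (toℕ k)) * 0#)
      ≈⟨ +-cong (*-identityʳ _) (trans (sum-cong-≋ {n} (λ k → zeroʳ (f (suc (toℕ k))))) (sum-replicate-zero n)) ⟩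
    f 0 + 0# ≈⟨ +-identityʳ _ ⟩
    f 0 ∎
  sum-basis f {suc n} (suc j) (s≤s j<n) =
    trans (+-congʳ (zeroʳ _)) (trans (+-identityˡ _) (sum-basis (λ k → f (suc k)) j j<n))

  basis-inject₁ : ∀ j {n} (k : Fin n) → basis j (inject₁ k) ≡ basis j k
  basis-inject₁ zero    zero    = ≡.refl
  basis-inject₁ zero    (suc k) = ≡.refl
  basis-inject₁ (suc j) zero    = ≡.refl
  basis-inject₁ (suc j) (suc k) = basis-inject₁ j k

  basis-outside : ∀ n (k : Fin n) → basis n k ≡ 0#
  basis-outside (suc n) zero    = ≡.refl
  basis-outside (suc n) (suc k) = basis-outside n k

  -- `times-root` is designed for this. On `basis j` its coordinate `zero` is a (j + 1), which
  -- cancels the term `con (a (suc j))`; the other coordinates shift by one place, and the two signs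
  -- cancel. The range includes j = m + 1, where `basis j` has left the module.
  quotient-basis : ∀ j → j < suc (suc m) → ⟦ quotient j ⟧ (basis 0) ≋ basis j
  quotient-basis zero    _         k       = *-identityˡ _
  quotient-basis (suc j) (s≤s j≤m) zero    = begin
    a (suc j) * 1# + - 1# * times-root (⟦ quotient j ⟧ (basis 0)) zero
      ≈⟨ +-cong (*-identityʳ _) (*-congˡ (⟦⟧-cong root (quotient-basis j (ℕ.m<n⇒m<1+n j≤m)) zero)) ⟩
    a (suc j) + - 1# * times-root (basis j) zero
      ≈⟨ +-congˡ (*-congˡ (sum-basis (λ k → a (suc k)) j j≤m)) ⟩
    a (suc j) + - 1# * a (suc j)
      ≈⟨ trans (+-comm _ _) (-1*x+x≈0 _) ⟩
    0# ∎
  quotient-basis (suc j) (s≤s j≤m) (suc k) = begin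
    a (suc j) * 0# + - 1# * - (⟦ quotient j ⟧ (basis 0) (inject₁ k))
      ≈⟨ +-cong (zeroʳ _) (-1*x≈-x _) ⟩
    0# + - - (⟦ quotient j ⟧ (basis 0) (inject₁ k))
      ≈⟨ trans (+-identityˡ _) (-‿involutive _) ⟩
    ⟦ quotient j ⟧ (basis 0) (inject₁ k)
      ≈⟨ quotient-basis j (ℕ.m<n⇒m<1+n j≤m) (inject₁ k) ⟩
    basis j (inject₁ k)
      ≡⟨ basis-inject₁ j k ⟩
    basis j k ∎

  -- The remainder of the division by 1 + root z vanishes; this is the polynomial equation satisfied
  -- by `root`.
  quotient-exact : quotient (suc m) ≈ᴱ con 0#
  quotient-exact = ⟪ (λ k → trans (quotient-basis (suc m) ℕ.≤-refl k)
    (trans (reflexive (basis-outside (suc m) k)) (sym (zeroˡ _)))) ⟫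

module Elementary (R : Ring₀) where
  open CommutativeRing R hiding (zero)

  elem : ∀ {N} → (Fin N → Carrier) → ℕ → Carrier
  elem {zero}  x zero    = 1#
  elem {zero}  x (suc k) = 0#
  elem {suc N} x zero    = elem (x ∘ suc) zero
  elem {suc N} x (suc k) = elem (x ∘ suc) (suc k) + x zero * elem (x ∘ suc) k

-- Induction on the degree bound: over `A[root]` the polynomial is (1 + root z) times one of smaller
-- degree bound. Factors 1 + x z keep the constant coefficient 1, so the leading coefficient is
-- never inverted; it may be a nilpotent such as ε.
splitting : ∀ m (A : Ring₀) (a : ℕ → Ring₀.Carrier A) →
  Ring₀._≈_ A (a 0) (Ring₀.1# A) → (∀ k → m < k → Ring₀._≈_ A (a k) (Ring₀.0# A)) →
  Σ[ E ∈ Extension A ] let open Extension E in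
    Σ[ x ∈ (Fin m → Ring₀.Carrier ring) ] ∀ k → Ring₀._≈_ ring (Elementary.elem ring x k) (ι (a k))
splitting zero A a a₀≈1 a≈0 = trivial , (λ ()) , λ { zero → sym a₀≈1 ; (suc k) → sym (a≈0 (suc k) (s≤s z≤n)) }
  where
  open CommutativeRing A using (rawRing; refl; sym)
  trivial : Extension A
  trivial = record { ring = A ; ι = id ; mono = Identity.isRingMonomorphism rawRing refl }
splitting (suc m) A a a₀≈1 a≈0 = E , x , elem-x
  where
  open AdjoinRoot A m a
  open CommutativeRing A using (-_; 1#)
  module A′ where
    open CommutativeRing A[root] public
    open Algebra.Properties.Ring (Ring₀.ring A[root]) public
  module con = Morphisms.IsRingMonomorphism con-mono

  quotient-vanishes : ∀ k → m < k → quotient k A′.≈ A′.0#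
  quotient-vanishes (suc k) (s≤s m≤k) with ℕ.m≤n⇒m<n∨m≡n m≤k
  ... | inj₂ ≡.refl = quotient-exact
  ... | inj₁ m<k = A′.trans
    (A′.+-cong (con.⟦⟧-cong (a≈0 (suc k) (s≤s m<k)))
      (A′.trans (A′.*-congˡ {con (- 1#)} (A′.*-congˡ {root} (quotient-vanishes k m<k)))
        (A′.trans (A′.*-congˡ {con (- 1#)} (A′.zeroʳ root)) (A′.zeroʳ (con (- 1#))))))
    (A′.+-identityˡ _)

  rest = splitting m A[root] quotient A′.refl quotient-vanishes
  module E′ = Extension (proj₁ rest)
  module ι′ = Morphisms.IsRingMonomorphism E′.mono
  x′ = proj₁ (proj₂ rest)
  elem-x′ = proj₂ (proj₂ rest)
  module R = CommutativeRing E′.ring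

  E : Extension A
  E = record
    { ring = E′.ring
    ; ι = E′.ι ∘ con
    ; mono = Composition.isRingMonomorphism R.trans con-mono E′.mono
    }

  x : Fin (suc m) → R.Carrier
  x = E′.ι root ∷ᶠ x′

  quotient-step : ∀ k → quotient (suc k) ⊕ root ⊗ quotient k A′.≈ con (a (suc k))
  quotient-step k = A′.trans
    (A′.+-assoc (con (a (suc k))) (con (- 1#) ⊗ (root ⊗ quotient k)) (root ⊗ quotient k))
    (A′.trans (A′.+-congˡ {con (a (suc k))} (A′.-‿inverseˡ (root ⊗ quotient k))) (A′.+-identityʳ _))

  elem-x : ∀ k → Elementary.elem E′.ring x k R.≈ E′.ι (con (a k))
  elem-x zero    = R.trans (elem-x′ zero) (ι′.⟦⟧-cong (con.⟦⟧-cong (Ring₀.sym A a₀≈1)))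
  elem-x (suc k) =
    R.trans (R.+-cong (elem-x′ (suc k)) (R.*-congˡ (elem-x′ k)))
    (R.trans (R.+-congˡ (R.sym (ι′.*-homo root (quotient k))))
    (R.trans (R.sym (ι′.+-homo (quotient (suc k)) (root ⊗ quotient k)))
      (ι′.⟦⟧-cong (quotient-step k))))

-- Finite sums and generating functions

module Sums (R : Ring₀) where
  open CommutativeRing R hiding (zero)
  open NatSolver commutativeSemiring using (solve; _:+_; _:=_)

  -- Over ℚ this and `𝟙` unfold to `∑[_]` and to the coefficients of `x^_`, so the lemmas below
  -- apply to the given definitions directly.
  ∑ : {X : Set} → List X → (X → Carrier) → Carrier
  ∑ xs f = foldr _+_ 0# (map f xs)

  𝟙 : Bool → Carrier
  𝟙 b = if b then 1# else 0#

  𝟙-∧ : ∀ b c → 𝟙 (b ∧ c) ≈ 𝟙 b * 𝟙 c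
  𝟙-∧ true  c = sym (*-identityˡ _)
  𝟙-∧ false c = sym (zeroˡ _)

  ∑-cong-∈ : ∀ {X : Set} (xs : List X) {f g} → (∀ x → x ∈ xs → f x ≈ g x) → ∑ xs f ≈ ∑ xs g
  ∑-cong-∈ []       f≈g = refl
  ∑-cong-∈ (x ∷ xs) f≈g = +-cong (f≈g x (here ≡.refl)) (∑-cong-∈ xs (λ y → f≈g y ∘ there))

  ∑-cong : ∀ {X : Set} (xs : List X) {f g} → (∀ x → f x ≈ g x) → ∑ xs f ≈ ∑ xs g
  ∑-cong xs f≈g = ∑-cong-∈ xs (λ x _ → f≈g x)

  ∑-++ : ∀ {X : Set} (xs ys : List X) f → ∑ (xs ++ ys) f ≈ ∑ xs f + ∑ ys f
  ∑-++ []       ys f = sym (+-identityˡ _)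
  ∑-++ (x ∷ xs) ys f = trans (+-congˡ (∑-++ xs ys f)) (sym (+-assoc _ _ _))

  ∑-0 : ∀ {X : Set} (xs : List X) → ∑ xs (λ _ → 0#) ≈ 0#
  ∑-0 []       = refl
  ∑-0 (x ∷ xs) = trans (+-identityˡ _) (∑-0 xs)

  ∑-+ : ∀ {X : Set} (xs : List X) f g → ∑ xs (λ x → f x + g x) ≈ ∑ xs f + ∑ xs g
  ∑-+ []       f g = sym (+-identityˡ _)
  ∑-+ (x ∷ xs) f g = trans (+-congˡ (∑-+ xs f g))
    (solve 4 (λ s t u x → (s :+ t) :+ (u :+ x) := (s :+ u) :+ (t :+ x)) refl _ _ _ _)

  ∑-*ˡ : ∀ {X : Set} (xs : List X) c f → ∑ xs (λ x → c * f x) ≈ c * ∑ xs f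
  ∑-*ˡ []       c f = sym (zeroʳ c)
  ∑-*ˡ (x ∷ xs) c f = trans (+-congˡ (∑-*ˡ xs c f)) (sym (distribˡ _ _ _))

  ∑-*ʳ : ∀ {X : Set} (xs : List X) c f → ∑ xs (λ x → f x * c) ≈ ∑ xs f * c
  ∑-*ʳ xs c f = trans (∑-cong xs (λ _ → *-comm _ _)) (trans (∑-*ˡ xs c f) (*-comm _ _))

  ∑-swap : ∀ {X Y : Set} (xs : List X) (ys : List Y) (f : X → Y → Carrier) →
    ∑ xs (λ x → ∑ ys (f x)) ≈ ∑ ys (λ y → ∑ xs (λ x → f x y))
  ∑-swap []       ys f = sym (∑-0 ys)
  ∑-swap (x ∷ xs) ys f = trans (+-congˡ (∑-swap xs ys f)) (sym (∑-+ ys (f x) _))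

  ∑-map : ∀ {X Y : Set} (xs : List X) (h : X → Y) f → ∑ (map h xs) f ≡ ∑ xs (f ∘ h)
  ∑-map xs h f = ≡.cong (foldr _+_ 0#) (≡.sym (map-∘ xs))

  ∑-cartesianProductWith : ∀ {X Y Z : Set} (h : X → Y → Z) xs ys f →
    ∑ (cartesianProductWith h xs ys) f ≈ ∑ xs (λ x → ∑ ys (λ y → f (h x y)))
  ∑-cartesianProductWith h []       ys f = refl
  ∑-cartesianProductWith h (x ∷ xs) ys f = trans (∑-++ (map (h x) ys) _ f)
    (+-cong (reflexive (∑-map ys (h x) f)) (∑-cartesianProductWith h xs ys f))

  ∑-product : ∀ {X Y : Set} (xs : List X) (ys : List Y) f g →
    ∑ xs (λ x → ∑ ys (λ y → f x * g y)) ≈ ∑ xs f * ∑ ys g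
  ∑-product xs ys f g = trans (∑-cong xs (λ x → ∑-*ˡ ys (f x) g)) (∑-*ʳ xs (∑ ys g) f)

  ∑-filter : ∀ {X : Set} {P : Pred X 0ℓ} (P? : Decidable P) xs f →
    ∑ (filter P? xs) f ≈ ∑ xs (λ x → 𝟙 (does (P? x)) * f x)
  ∑-filter P? []       f = refl
  ∑-filter P? (x ∷ xs) f with does (P? x)
  ... | true  = +-cong (sym (*-identityˡ _)) (∑-filter P? xs f)
  ... | false = trans (∑-filter P? xs f) (sym (trans (+-congʳ (zeroˡ _)) (+-identityˡ _)))

  ∑-allFin : ∀ N (f : Fin (suc N) → Carrier) → ∑ (allFin (suc N)) f ≡ f zero + ∑ (allFin N) (f ∘ suc)
  ∑-allFin N f = ≡.cong (λ ys → f zero + foldr _+_ 0# ys)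
    (≡.trans (map-tabulate suc f) (≡.sym (map-tabulate id (f ∘ suc))))

  module _ {X : Set} (_≟_ : DecidableEquality X) where

    ∑-∉ : ∀ {xs y} → y ∉ xs → (f : X → Carrier) → ∑ xs (λ x → 𝟙 (does (x ≟ y)) * f x) ≈ 0#
    ∑-∉ {[]}     y∉ f = refl
    ∑-∉ {x ∷ xs} {y} y∉ f rewrite dec-false (x ≟ y) (λ x≡y → y∉ (here (≡.sym x≡y))) =
      trans (+-cong (zeroˡ _) (∑-∉ (y∉ ∘ there) f)) (+-identityˡ _)

    ∑-∈ : ∀ {xs y} → Unique xs → y ∈ xs → (f : X → Carrier) → ∑ xs (λ x → 𝟙 (does (x ≟ y)) * f x) ≈ f y
    ∑-∈ {x ∷ xs} (x∉ ∷ _) (here ≡.refl) f rewrite dec-true (x ≟ x) ≡.refl =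
      trans (+-cong (*-identityˡ _) (∑-∉ (λ x∈ → All.lookup x∉ x∈ ≡.refl) f)) (+-identityʳ _)
    ∑-∈ {x ∷ xs} {y} (x∉ ∷ u) (there y∈) f rewrite dec-false (x ≟ y) (All.lookup x∉ y∈) =
      trans (+-cong (zeroˡ _) (∑-∈ u y∈ f)) (+-identityˡ _)

module Convolution (R : Ring₀) where
  open CommutativeRing R hiding (zero)
  open Algebra.Properties.Semiring.Mult semiring using () renaming (_×_ to _×ʳ_)
  open Elementary R
  open Sums R
  open SetoidReasoning setoid
  open NatSolver commutativeSemiring using (solve; _:+_; _:*_; _:=_; con)

  infix 4 _≗_
  _≗_ : (f g : ℕ → Carrier) → Set
  f ≗ g = ∀ m → f m ≈ g m

  -- The Cauchy product of generating functions; `shift` is multiplication by z.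
  conv : (ℕ → Carrier) → (ℕ → Carrier) → ℕ → Carrier
  conv a f zero    = a 0 * f 0
  conv a f (suc m) = a 0 * f (suc m) + conv (a ∘ suc) f m

  shift : (ℕ → Carrier) → ℕ → Carrier
  shift f zero    = 0#
  shift f (suc m) = f m

  shift-cong : ∀ {f g} → f ≗ g → shift f ≗ shift g
  shift-cong f≗g zero    = refl
  shift-cong f≗g (suc m) = f≗g m

  conv-cong : ∀ {a b f g} → a ≗ b → f ≗ g → conv a f ≗ conv b g
  conv-cong a≗b f≗g zero    = *-cong (a≗b 0) (f≗g 0)
  conv-cong a≗b f≗g (suc m) = +-cong (*-cong (a≗b 0) (f≗g (suc m))) (conv-cong (a≗b ∘ suc) f≗g m)

  conv-+ˡ : ∀ a b f → conv (λ k → a k + b k) f ≗ λ m → conv a f m + conv b f m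
  conv-+ˡ a b f zero    = distribʳ _ _ _
  conv-+ˡ a b f (suc m) = trans (+-cong (distribʳ _ _ _) (conv-+ˡ (a ∘ suc) (b ∘ suc) f m))
    (solve 4 (λ s t u x → (s :+ t) :+ (u :+ x) := (s :+ u) :+ (t :+ x)) refl _ _ _ _)

  conv-+ʳ : ∀ a f g → conv a (λ k → f k + g k) ≗ λ m → conv a f m + conv a g m
  conv-+ʳ a f g zero    = distribˡ _ _ _
  conv-+ʳ a f g (suc m) = trans (+-cong (distribˡ _ _ _) (conv-+ʳ (a ∘ suc) f g m))
    (solve 4 (λ s t u x → (s :+ t) :+ (u :+ x) := (s :+ u) :+ (t :+ x)) refl _ _ _ _)

  conv-*ˡ : ∀ c a f → conv (λ k → c * a k) f ≗ λ m → c * conv a f m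
  conv-*ˡ c a f zero    = *-assoc _ _ _
  conv-*ˡ c a f (suc m) = trans (+-cong (*-assoc _ _ _) (conv-*ˡ c (a ∘ suc) f m)) (sym (distribˡ _ _ _))

  conv-*ʳ : ∀ c a f → conv a (λ k → c * f k) ≗ λ m → c * conv a f m
  conv-*ʳ c a f zero    = solve 3 (λ c a f → a :* (c :* f) := c :* (a :* f)) refl c _ _
  conv-*ʳ c a f (suc m) = trans
    (+-cong (solve 3 (λ c a f → a :* (c :* f) := c :* (a :* f)) refl c _ _) (conv-*ʳ c (a ∘ suc) f m))
    (sym (distribˡ _ _ _))

  conv-shiftˡ : ∀ a f → conv (shift a) f ≗ shift (conv a f)
  conv-shiftˡ a f zero    = zeroˡ _
  conv-shiftˡ a f (suc m) = trans (+-congʳ (zeroˡ _)) (+-identityˡ _)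

  conv-shiftʳ : ∀ a f → conv a (shift f) ≗ shift (conv a f)
  conv-shiftʳ a f zero          = zeroʳ _
  conv-shiftʳ a f (suc zero)    = trans (+-congˡ (zeroʳ _)) (+-identityʳ _)
  conv-shiftʳ a f (suc (suc m)) = +-congˡ (conv-shiftʳ (a ∘ suc) f (suc m))

  -- Multiplication of a generating function by 1 + y z.
  times : Carrier → (ℕ → Carrier) → ℕ → Carrier
  times y f m = f m + y * shift f m

  conv-timesˡ : ∀ y a f → conv (times y a) f ≗ times y (conv a f)
  conv-timesˡ y a f m = trans (conv-+ˡ a (λ k → y * shift a k) f m)
    (+-congˡ (trans (conv-*ˡ y (shift a) f m) (*-congˡ (conv-shiftˡ a f m))))

  conv-timesʳ : ∀ y a f → conv a (times y f) ≗ times y (conv a f)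
  conv-timesʳ y a f m = trans (conv-+ʳ a f (λ k → y * shift f k) m)
    (+-congˡ (trans (conv-*ʳ y a (shift f) m) (*-congˡ (conv-shiftʳ a f m))))

  -- The coefficients of z E′(z), where E(z) = Σ e_k z^k.
  elem′ : ∀ {N} → (Fin N → Carrier) → ℕ → Carrier
  elem′ x k = (k ×ʳ 1#) * elem x k

  elem-times : ∀ {N} (x : Fin (suc N) → Carrier) → elem x ≗ times (x zero) (elem (x ∘ suc))
  elem-times x zero    = sym (trans (+-congˡ (zeroʳ _)) (+-identityʳ _))
  elem-times x (suc k) = refl

  -- The product rule for z d/dz applied to (1 + y z) F(z).
  elem′-times : ∀ {N} (x : Fin (suc N) → Carrier) →
    elem′ x ≗ λ k → x zero * shift (elem (x ∘ suc)) k + times (x zero) (elem′ (x ∘ suc)) k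
  elem′-times x zero    = solve 2 (λ y f → con 0 :* f := y :* con 0 :+ (con 0 :* f :+ y :* con 0)) refl _ _
  elem′-times x (suc k) = solve 4 (λ y k f g →
    (con 1 :+ k) :* (g :+ y :* f) := y :* f :+ ((con 1 :+ k) :* g :+ y :* (k :* f))) refl _ _ _ _

  -- Multiplying Σ_c x_c z / (1 + x_c z) by E(z) = ∏ (1 + x_c z) gives z E′(z).
  conv-log-derivative : ∀ {N} (x : Fin N → Carrier) (X : ℕ → Carrier) (P : Fin N → ℕ → Carrier) →
    (∀ c → times (x c) (P c) ≗ X) →
    conv (elem x) (λ m → ∑ (allFin N) (λ c → x c * shift (P c) m)) ≗ conv (elem′ x) X
  conv-log-derivative {zero} x X P P-X m = trans (annihilate (elem x) m) (sym (vanish (elem′ x) elem′≈0 m))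
    where
    annihilate : ∀ a → conv a (λ _ → 0#) ≗ λ _ → 0#
    annihilate a zero    = zeroʳ _
    annihilate a (suc m) = trans (+-cong (zeroʳ _) (annihilate (a ∘ suc) m)) (+-identityˡ _)
    vanish : ∀ a → (∀ k → a k ≈ 0#) → conv a X ≗ λ _ → 0#
    vanish a a≈0 zero    = trans (*-congʳ (a≈0 0)) (zeroˡ _)
    vanish a a≈0 (suc m) = trans (+-cong (trans (*-congʳ (a≈0 0)) (zeroˡ _)) (vanish (a ∘ suc) (a≈0 ∘ suc) m)) (+-identityˡ _)
    elem′≈0 : ∀ k → elem′ x k ≈ 0#
    elem′≈0 zero    = zeroˡ _
    elem′≈0 (suc k) = zeroʳ _
  conv-log-derivative {suc N} x X P P-X m = begin
    conv (elem x) (λ m → ∑ (allFin (suc N)) (λ c → x c * shift (P c) m)) m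
      ≈⟨ conv-cong (elem-times x) (λ m → reflexive (∑-allFin N (λ c → x c * shift (P c) m))) m ⟩
    conv (times y F) (λ m → G m + H m) m
      ≈⟨ conv-timesˡ y F _ m ⟩
    times y (conv F (λ m → G m + H m)) m
      ≈⟨ sym (conv-timesʳ y F _ m) ⟩
    -- The factor 1 + y z moves to the second argument, where it turns `P zero` into `X`; from `H`
    -- it is moved out again, which leaves the induction hypothesis.
    conv F (times y (λ m → G m + H m)) m
      ≈⟨ conv-cong (λ _ → refl) times-+ m ⟩
    conv F (λ m → y * shift X m + times y H m) m
      ≈⟨ conv-+ʳ F (λ m → y * shift X m) (times y H) m ⟩
    conv F (λ m → y * shift X m) m + conv F (times y H) m
      ≈⟨ +-cong (trans (conv-*ʳ y F (shift X) m) (*-congˡ (conv-shiftʳ F X m))) (conv-timesʳ y F H m) ⟩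
    y * shift (conv F X) m + times y (conv F H) m
      ≈⟨ +-congˡ (+-cong (IH m) (*-congˡ (shift-cong IH m))) ⟩
    y * shift (conv F X) m + times y (conv F′ X) m
      ≈⟨ +-cong (*-congˡ (sym (conv-shiftˡ F X m))) (sym (conv-timesˡ y F′ X m)) ⟩
    y * conv (shift F) X m + conv (times y F′) X m
      ≈⟨ +-congʳ (sym (conv-*ˡ y (shift F) X m)) ⟩
    conv (λ k → y * shift F k) X m + conv (times y F′) X m
      ≈⟨ sym (conv-+ˡ (λ k → y * shift F k) (times y F′) X m) ⟩
    conv (λ k → y * shift F k + times y F′ k) X m
      ≈⟨ conv-cong (λ k → sym (elem′-times x k)) (λ _ → refl) m ⟩
    conv (elem′ x) X m ∎
    where
    y = x zero
    F = elem (x ∘ suc)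
    F′ = elem′ (x ∘ suc)
    G H : ℕ → Carrier
    G m = y * shift (P zero) m
    H m = ∑ (allFin N) (λ c → x (suc c) * shift (P (suc c)) m)
    IH : conv F H ≗ conv F′ X
    IH = conv-log-derivative (x ∘ suc) X (P ∘ suc) (P-X ∘ suc)
    times-+ : times y (λ m → G m + H m) ≗ λ m → y * shift X m + times y H m
    times-+ zero    = solve 2 (λ y h → (y :* con 0 :+ h) :+ y :* con 0 := y :* con 0 :+ (h :+ y :* con 0)) refl y (H 0)
    times-+ (suc m) = trans
      (solve 5 (λ y p q h i → (y :* p :+ h) :+ y :* (y :* q :+ i) := y :* (p :+ y :* q) :+ (h :+ y :* i)) refl
        y (P zero m) (shift (P zero) m) (H (suc m)) (H m))
      (+-congʳ (*-congˡ (P-X zero m)))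

  -- With X(z) = 1 + Σ_c x_c z P_c(z), where P_c(z) = X(z) / (1 + x_c z), this is E X = E + z E′ X.
  path-recurrence : ∀ {N} (x : Fin N → Carrier) (X : ℕ → Carrier) (P : Fin N → ℕ → Carrier) →
    (∀ c → times (x c) (P c) ≗ X) → X 0 ≈ 1# →
    (∀ m → X (suc m) ≈ ∑ (allFin N) (λ c → x c * P c m)) →
    ∀ m → conv (elem x) X m ≈ elem x m + conv (elem′ x) X m
  path-recurrence {N} x X P P-X X₀ X₊ m = begin
    conv (elem x) X m
      ≈⟨ conv-cong (λ _ → refl) split m ⟩
    conv (elem x) (λ m → δ m + ∑ (allFin N) (λ c → x c * shift (P c) m)) m
      ≈⟨ conv-+ʳ (elem x) δ _ m ⟩
    conv (elem x) δ m + conv (elem x) (λ m → ∑ (allFin N) (λ c → x c * shift (P c) m)) m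
      ≈⟨ +-cong (conv-δ (elem x) m) (conv-log-derivative x X P P-X m) ⟩
    elem x m + conv (elem′ x) X m ∎
    where
    δ : ℕ → Carrier
    δ zero    = 1#
    δ (suc _) = 0#
    conv-δ : ∀ a → conv a δ ≗ a
    conv-δ a zero    = *-identityʳ _
    conv-δ a (suc m) = trans (+-cong (zeroʳ _) (conv-δ (a ∘ suc) m)) (+-identityˡ _)
    split : X ≗ λ m → δ m + ∑ (allFin N) (λ c → x c * shift (P c) m)
    split zero    = trans X₀ (sym (trans (+-congˡ
      (trans (∑-cong (allFin N) (λ c → zeroʳ (x c))) (∑-0 (allFin N)))) (+-identityʳ _)))
    split (suc m) = trans (X₊ m) (sym (+-identityˡ _))

-- Paths and spiders in commuting variables

module PathSums (R : Ring₀) {N} (x : Fin N → Ring₀.Carrier R) where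
  open CommutativeRing R hiding (zero)
  open Algebra.Properties.Ring (Ring₀.ring R) using (+-cancelʳ)
  open Elementary R
  open Sums R
  open Convolution R
  open SetoidReasoning setoid
  open NatSolver commutativeSemiring using (solve; _:+_; _:*_; _:=_; con)

  ∑ᶜ : (Fin N → Carrier) → Carrier
  ∑ᶜ = ∑ (allFin N)

  -- P c ℓ sums over the proper colourings of a path with ℓ edges that starts at a vertex of colour c,
  -- whose variable is left out; X ℓ is the chromatic symmetric function of a path with ℓ vertices.
  P : Fin N → ℕ → Carrier
  P c zero    = 1#
  P c (suc ℓ) = ∑ᶜ (λ c′ → 𝟙 (does (¬? (c ≟ᶠ c′))) * (x c′ * P c′ ℓ))

  X : ℕ → Carrier
  X zero    = 1#
  X (suc ℓ) = ∑ᶜ (λ c → x c * P c ℓ)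

  -- The first vertex of a path that is not joined to a vertex of colour `c` has either another
  -- colour or the colour `c` itself.
  P-step : ∀ c ℓ → P c (suc ℓ) + x c * P c ℓ ≈ X (suc ℓ)
  P-step c ℓ = begin
    P c (suc ℓ) + x c * P c ℓ
      ≈⟨ +-congˡ (sym (∑-∈ _≟ᶠ_ (allFin⁺ N) (∈-allFin c) (λ c′ → x c′ * P c′ ℓ))) ⟩
    P c (suc ℓ) + ∑ᶜ (λ c′ → 𝟙 (does (c′ ≟ᶠ c)) * (x c′ * P c′ ℓ))
      ≈⟨ sym (∑-+ (allFin N) _ _) ⟩
    ∑ᶜ (λ c′ → 𝟙 (does (¬? (c ≟ᶠ c′))) * (x c′ * P c′ ℓ) + 𝟙 (does (c′ ≟ᶠ c)) * (x c′ * P c′ ℓ))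
      ≈⟨ ∑-cong (allFin N) complement ⟩
    X (suc ℓ) ∎
    where
    complement : ∀ c′ →
      𝟙 (does (¬? (c ≟ᶠ c′))) * (x c′ * P c′ ℓ) + 𝟙 (does (c′ ≟ᶠ c)) * (x c′ * P c′ ℓ) ≈ x c′ * P c′ ℓ
    complement c′ with c ≟ᶠ c′
    ... | yes ≡.refl rewrite dec-true (c ≟ᶠ c) ≡.refl = solve 1 (λ y → con 0 :* y :+ con 1 :* y := y) refl _
    ... | no c≢c′ rewrite dec-false (c′ ≟ᶠ c) (c≢c′ ∘ ≡.sym) = solve 1 (λ y → con 1 :* y :+ con 0 :* y := y) refl _

  X-recurrence : ∀ m → conv (elem x) X m ≈ elem x m + conv (elem′ x) X m
  X-recurrence = path-recurrence x X P P-X refl (λ _ → refl)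
    where
    P-X : ∀ c → times (x c) (P c) ≗ X
    P-X c zero    = trans (+-congˡ (zeroʳ _)) (+-identityʳ _)
    P-X c (suc ℓ) = P-step c ℓ

  -- Detaching a leg: the detached path is coloured freely, and the correction collects the
  -- colourings in which its first vertex has the colour of the vertex that carried it.
  joined : ∀ (f : Fin N → Carrier) a →
    ∑ᶜ (λ c → f c * P c (suc a)) + ∑ᶜ (λ c → f c * (x c * P c a)) ≈ ∑ᶜ f * X (suc a)
  joined f a = begin
    ∑ᶜ (λ c → f c * P c (suc a)) + ∑ᶜ (λ c → f c * (x c * P c a))
      ≈⟨ sym (∑-+ (allFin N) _ _) ⟩
    ∑ᶜ (λ c → f c * P c (suc a) + f c * (x c * P c a))
      ≈⟨ ∑-cong (allFin N) (λ c → trans (sym (distribˡ _ _ _)) (*-congˡ (P-step c a))) ⟩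
    ∑ᶜ (λ c → f c * X (suc a))
      ≈⟨ ∑-*ʳ (allFin N) (X (suc a)) f ⟩
    ∑ᶜ f * X (suc a) ∎

  -- `T` belongs to the path with a + b + 1 vertices, seen from an inner vertex. `Q` counts pairs of
  -- disjoint paths with a + 1 and b + 1 vertices whose first vertices share their colour.
  T Q : ℕ → ℕ → Carrier
  T a b = ∑ᶜ (λ c → x c * P c b * P c a)
  Q a b = ∑ᶜ (λ c → x c * P c b * (x c * P c a))

  T+Q : ∀ a b → T (suc a) b + Q a b ≈ X (suc b) * X (suc a)
  T+Q a b = joined (λ c → x c * P c b) a

  T-sym : ∀ a b → T a b ≈ T b a
  T-sym a b = ∑-cong (allFin N) (λ c → solve 3 (λ x p q → x :* p :* q := x :* q :* p) refl _ _ _)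

  Q-sym : ∀ a b → Q a b ≈ Q b a
  Q-sym a b = ∑-cong (allFin N) (λ c → solve 3 (λ x p q → x :* p :* (x :* q) := x :* q :* (x :* p)) refl _ _ _)

  -- Both sides are completed by the same symmetric `Q a b` to the same product, so the marked
  -- vertex can move along the path.
  T-slide : ∀ a b → T (suc a) b ≈ T a (suc b)
  T-slide a b = +-cancelʳ (Q a b) _ _ (begin
    T (suc a) b + Q a b   ≈⟨ T+Q a b ⟩
    X (suc b) * X (suc a) ≈⟨ *-comm _ _ ⟩
    X (suc a) * X (suc b) ≈⟨ sym (T+Q b a) ⟩
    T (suc b) a + Q b a   ≈⟨ +-cong (T-sym (suc b) a) (Q-sym b a) ⟩
    T a (suc b) + Q a b   ∎)

  T-path : ∀ a b → T a b ≈ X (suc (a ℕ.+ b))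
  T-path zero    b = ∑-cong (allFin N) (λ c → *-identityʳ _)
  T-path (suc a) b = trans (T-slide a b) (trans (T-path a (suc b))
    (reflexive (≡.cong (X ∘ suc) (ℕ.+-suc a b))))

  X+Q : ∀ a b → X (suc (suc (a ℕ.+ b))) + Q a b ≈ X (suc b) * X (suc a)
  X+Q a b = trans (+-congʳ (sym (T-path (suc a) b))) (T+Q a b)

  -- The expansion of S(a,b,2) in products of paths (Zheng).
  spider-paths : ∀ a b →
    ∑ᶜ (λ c → x c * (P c a * (P c b * P c 2))) + (X (suc a) * X (2 ℕ.+ b) + X (2 ℕ.+ a) * X (suc b))
      ≈ X (3 ℕ.+ (a ℕ.+ b)) + (X 1 * X (2 ℕ.+ (a ℕ.+ b)) + X 2 * X (suc (a ℕ.+ b)))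
  -- Detaching the leg of length 2 from `S` leaves the correction `D`, and detaching the remaining
  -- edge from `D` leaves `C`. The same `C` arises on detaching a path with a + 1 vertices from
  -- `Q 0 b`. Both routes produce the triple product X_1 X_{a+1} X_{b+1}, which cancels. Adding
  -- `C + D` on both sides avoids subtraction.
  spider-paths a b = +-cancelʳ (C + D) _ _ (begin
    (S + (X (suc a) * X (2 ℕ.+ b) + X (2 ℕ.+ a) * X (suc b))) + (C + D)
      ≈⟨ +-congʳ (+-congˡ (+-congˡ (trans (*-comm _ _) (sym (X+Q (suc a) b))))) ⟩
    (S + (X (suc a) * X (2 ℕ.+ b) + (X (3 ℕ.+ (a ℕ.+ b)) + Q (suc a) b))) + (C + D)
      ≈⟨ solve 6 (λ s u n q c d → (s :+ (u :+ (n :+ q))) :+ (c :+ d) := (n :+ (s :+ d)) :+ (u :+ (q :+ c))) refl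
           S _ _ (Q (suc a) b) C D ⟩
    (X (3 ℕ.+ (a ℕ.+ b)) + (S + D)) + (X (suc a) * X (2 ℕ.+ b) + (Q (suc a) b + C))
      ≈⟨ +-cong (+-congˡ S+D) (+-congˡ Q+C) ⟩
    (X (3 ℕ.+ (a ℕ.+ b)) + X (suc (a ℕ.+ b)) * X 2) + (X (suc a) * X (2 ℕ.+ b) + Q 0 b * X (suc a))
      ≈⟨ +-congˡ (trans (solve 3 (λ s t q → s :* t :+ q :* s := (t :+ q) :* s) refl _ _ _)
           (trans (*-congʳ (X+Q 0 b))
             (solve 3 (λ s t u → t :* s :* u := (t :* u) :* s) refl (X 1) (X (suc b)) (X (suc a))))) ⟩
    (X (3 ℕ.+ (a ℕ.+ b)) + X (suc (a ℕ.+ b)) * X 2) + X (suc b) * X (suc a) * X 1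
      ≈⟨ +-congˡ (*-congʳ (sym (X+Q a b))) ⟩
    (X (3 ℕ.+ (a ℕ.+ b)) + X (suc (a ℕ.+ b)) * X 2) + (X (2 ℕ.+ (a ℕ.+ b)) + Q a b) * X 1
      ≈⟨ solve 6 (λ n m o q s t → (n :+ o :* t) :+ (m :+ q) :* s := (n :+ (s :* m :+ t :* o)) :+ q :* s) refl
           _ _ _ (Q a b) (X 1) (X 2) ⟩
    (X (3 ℕ.+ (a ℕ.+ b)) + (X 1 * X (2 ℕ.+ (a ℕ.+ b)) + X 2 * X (suc (a ℕ.+ b)))) + Q a b * X 1
      ≈⟨ +-congˡ (trans (sym D+C) (+-comm D C)) ⟩
    (X (3 ℕ.+ (a ℕ.+ b)) + (X 1 * X (2 ℕ.+ (a ℕ.+ b)) + X 2 * X (suc (a ℕ.+ b)))) + (C + D) ∎)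
    where
    S = ∑ᶜ (λ c → x c * (P c a * (P c b * P c 2)))
    C = ∑ᶜ (λ c → x c * P c b * (x c * P c a) * (x c * P c 0))
    D = ∑ᶜ (λ c → x c * P c b * (x c * P c a) * P c 1)

    S+D : S + D ≈ X (suc (a ℕ.+ b)) * X 2
    S+D = begin
      S + D
        ≈⟨ +-cong
             (∑-cong (allFin N) (λ c → solve 4 (λ x p q r → x :* (p :* (q :* r)) := x :* q :* p :* r) refl
               (x c) (P c a) (P c b) (P c 2)))
             (∑-cong (allFin N) (λ c → solve 4 (λ x p q r → x :* q :* (x :* p) :* r := x :* q :* p :* (x :* r)) refl
               (x c) (P c a) (P c b) (P c 1))) ⟩
      ∑ᶜ (λ c → x c * P c b * P c a * P c 2) + ∑ᶜ (λ c → x c * P c b * P c a * (x c * P c 1))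
        ≈⟨ joined (λ c → x c * P c b * P c a) 1 ⟩
      T a b * X 2
        ≈⟨ *-congʳ (T-path a b) ⟩
      X (suc (a ℕ.+ b)) * X 2 ∎

    D+C : D + C ≈ Q a b * X 1
    D+C = joined (λ c → x c * P c b * (x c * P c a)) 0

    Q+C : Q (suc a) b + C ≈ Q 0 b * X (suc a)
    Q+C = begin
      Q (suc a) b + C
        ≈⟨ +-cong
             (∑-cong (allFin N) (λ c → solve 3 (λ x p q → x :* q :* (x :* p) := x :* q :* (x :* con 1) :* p) refl
               (x c) (P c (suc a)) (P c b)))
             (∑-cong (allFin N) (λ c → solve 3 (λ x p q → x :* q :* (x :* p) :* (x :* con 1) := x :* q :* (x :* con 1) :* (x :* p)) refl
               (x c) (P c a) (P c b))) ⟩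
      ∑ᶜ (λ c → x c * P c b * (x c * P c 0) * P c (suc a)) + ∑ᶜ (λ c → x c * P c b * (x c * P c 0) * (x c * P c a))
        ≈⟨ joined (λ c → x c * P c b * (x c * P c 0)) a ⟩
      Q 0 b * X (suc a) ∎

-- Path values when e_{d+1} = 1, e_{d+2} = w and all other e_k with k > 0 vanish

module Coefficients (R : Ring₀) where
  open CommutativeRing R hiding (zero)

  -- z^d (1 + w z)
  binomial : ℕ → Carrier → ℕ → Carrier
  binomial zero    w zero          = 1#
  binomial zero    w (suc zero)    = w
  binomial zero    w (suc (suc _)) = 0#
  binomial (suc d) w zero          = 0#
  binomial (suc d) w (suc k)       = binomial d w k

  -- 1 + z^(d+1) + w z^(d+2)
  trinomial : ℕ → Carrier → ℕ → Carrier
  trinomial d w zero    = 1#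
  trinomial d w (suc k) = binomial d w k

  binomial-low : ∀ d w {k} → k < d → binomial d w k ≡ 0#
  binomial-low (suc d) w {zero}  _         = ≡.refl
  binomial-low (suc d) w {suc k} (s≤s k<d) = binomial-low d w k<d

  binomial-high : ∀ d w {k} → suc d < k → binomial d w k ≡ 0#
  binomial-high zero    w {suc (suc k)} _         = ≡.refl
  binomial-high zero    w {suc zero}    (s≤s ())
  binomial-high (suc d) w {suc k}       (s≤s d<k) = binomial-high d w d<k

  binomial-+ : ∀ d w j → binomial d w (d ℕ.+ j) ≡ binomial 0 w j
  binomial-+ zero    w j = ≡.refl
  binomial-+ (suc d) w j = binomial-+ d w j

module SparsePaths (R : Ring₀) {N} (x : Fin N → Ring₀.Carrier R) (d : ℕ) (w : Ring₀.Carrier R)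
  (elem-x : ∀ k → Ring₀._≈_ R (Elementary.elem R x k) (Coefficients.trinomial R d w k)) where
  open CommutativeRing R hiding (zero)
  open Algebra.Properties.Ring (Ring₀.ring R) using (+-cancelʳ)
  open Algebra.Properties.Semiring.Mult semiring using () renaming (_×_ to _×ʳ_)
  open Elementary R
  open Coefficients R
  open Convolution R
  open PathSums R x
  open SetoidReasoning setoid
  open NatSolver commutativeSemiring using (solve; _:+_; _:*_; _:=_; con)

  -- Serves both sides of the recurrence: μ = 1 gives (E - 1) / z, and μ k = k + 1 gives E′. The
  -- exponent is an argument of its own so that leading zeros can be removed by induction.
  scaled : (ℕ → Carrier) → ℕ → ℕ → Carrier
  scaled μ d k = μ k * binomial d w k

  conv-0 : ∀ a → (∀ k → a k ≈ 0#) → ∀ f m → conv a f m ≈ 0#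
  conv-0 a a≈0 f zero    = trans (*-congʳ (a≈0 0)) (zeroˡ _)
  conv-0 a a≈0 f (suc m) = trans
    (+-cong (trans (*-congʳ (a≈0 0)) (zeroˡ _)) (conv-0 (a ∘ suc) (a≈0 ∘ suc) f m)) (+-identityˡ _)

  conv-scaled-low : ∀ μ d f {m} → m < d → conv (scaled μ d) f m ≈ 0#
  conv-scaled-low μ (suc d) f {zero}  _         = trans (*-congʳ (zeroʳ _)) (zeroˡ _)
  conv-scaled-low μ (suc d) f {suc m} (s≤s m<d) = trans
    (+-cong (trans (*-congʳ (zeroʳ _)) (zeroˡ _)) (conv-scaled-low (μ ∘ suc) d f m<d)) (+-identityˡ _)

  conv-scaled-+ : ∀ μ d f j → conv (scaled μ d) f (d ℕ.+ j) ≈ conv (scaled (λ k → μ (d ℕ.+ k)) 0) f j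
  conv-scaled-+ μ zero    f j = refl
  conv-scaled-+ μ (suc d) f j = trans (+-congʳ (trans (*-congʳ (zeroʳ _)) (zeroˡ _)))
    (trans (+-identityˡ _) (conv-scaled-+ (μ ∘ suc) d f j))

  conv-scaled-suc : ∀ μ f j → conv (scaled μ 0) f (suc j) ≈ μ 0 * f (suc j) + μ 1 * w * f j
  conv-scaled-suc μ f zero    = +-congʳ (*-congʳ (*-identityʳ _))
  conv-scaled-suc μ f (suc j) = +-cong (*-congʳ (*-identityʳ _))
    (trans (+-congˡ (conv-0 (λ k → scaled μ 0 (suc (suc k))) (λ _ → zeroʳ _) f j)) (+-identityʳ _))

  next : ∀ m → X (suc m) + conv (scaled (λ _ → 1#) d) X m
             ≈ binomial d w m + conv (scaled (λ k → suc k ×ʳ 1#) d) X m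
  next m = begin
    X (suc m) + conv (scaled (λ _ → 1#) d) X m
      ≈⟨ +-cong (sym (trans (*-congʳ (elem-x 0)) (*-identityˡ _)))
           (conv-cong (λ k → trans (*-identityˡ _) (sym (elem-x (suc k)))) (λ _ → refl) m) ⟩
    conv (elem x) X (suc m)
      ≈⟨ X-recurrence (suc m) ⟩
    elem x (suc m) + (0# * elem x 0 * X (suc m) + conv (elem′ x ∘ suc) X m)
      ≈⟨ +-cong (elem-x (suc m)) (+-cong (trans (*-congʳ (zeroˡ _)) (zeroˡ _))
           (conv-cong (λ k → *-congˡ (elem-x (suc k))) (λ _ → refl) m)) ⟩
    binomial d w m + (0# + conv (scaled (λ k → suc k ×ʳ 1#) d) X m)
      ≈⟨ +-congˡ (+-identityˡ _) ⟩
    binomial d w m + conv (scaled (λ k → suc k ×ʳ 1#) d) X m ∎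

  next-+ : ∀ j → X (suc (d ℕ.+ j)) + conv (scaled (λ _ → 1#) 0) X j
               ≈ binomial 0 w j + conv (scaled (λ k → suc (d ℕ.+ k) ×ʳ 1#) 0) X j
  next-+ j = begin
    X (suc (d ℕ.+ j)) + conv (scaled (λ _ → 1#) 0) X j
      ≈⟨ +-congˡ (sym (conv-scaled-+ (λ _ → 1#) d X j)) ⟩
    X (suc (d ℕ.+ j)) + conv (scaled (λ _ → 1#) d) X (d ℕ.+ j)
      ≈⟨ next (d ℕ.+ j) ⟩
    binomial d w (d ℕ.+ j) + conv (scaled (λ k → suc k ×ʳ 1#) d) X (d ℕ.+ j)
      ≈⟨ +-cong (reflexive (binomial-+ d w j)) (conv-scaled-+ (λ k → suc k ×ʳ 1#) d X j) ⟩
    binomial 0 w j + conv (scaled (λ k → suc (d ℕ.+ k) ×ʳ 1#) 0) X j ∎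

  X-low : ∀ {m} → m < d → X (suc m) ≈ 0#
  X-low {m} m<d = begin
    X (suc m)                                   ≈⟨ sym (+-identityʳ _) ⟩
    X (suc m) + 0#                              ≈⟨ +-congˡ (sym (conv-scaled-low (λ _ → 1#) d X m<d)) ⟩
    X (suc m) + conv (scaled (λ _ → 1#) d) X m  ≈⟨ next m ⟩
    binomial d w m + conv (scaled (λ k → suc k ×ʳ 1#) d) X m
      ≈⟨ +-cong (reflexive (binomial-low d w m<d)) (conv-scaled-low (λ k → suc k ×ʳ 1#) d X m<d) ⟩
    0# + 0#                                     ≈⟨ +-identityˡ _ ⟩
    0# ∎

  -- In E / (E - z E′) the denominator contributes d and the numerator 1.
  X-d+1 : X (suc d) ≈ suc d ×ʳ 1#
  X-d+1 = +-cancelʳ 1# _ _ (begin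
    X (suc d) + 1#
      ≈⟨ +-cong (reflexive (≡.cong (X ∘ suc) (≡.sym (ℕ.+-identityʳ d))))
           (solve 0 (con 1 := con 1 :* con 1 :* con 1) refl) ⟩
    X (suc (d ℕ.+ 0)) + 1# * 1# * 1#
      ≈⟨ next-+ 0 ⟩
    1# + (suc (d ℕ.+ 0) ×ʳ 1#) * 1# * 1#
      ≈⟨ solve 1 (λ n → con 1 :+ n :* con 1 :* con 1 := n :+ con 1) refl _ ⟩
    suc (d ℕ.+ 0) ×ʳ 1# + 1#
      ≈⟨ +-congʳ (reflexive (≡.cong (λ n → suc n ×ʳ 1#) (ℕ.+-identityʳ d))) ⟩
    suc d ×ʳ 1# + 1# ∎)

  next-suc : ∀ j → X (2 ℕ.+ (d ℕ.+ j)) + X (suc j) + w * X j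
               ≈ binomial 0 w (suc j) + ((suc d ×ʳ 1#) * X (suc j) + ((2 ℕ.+ d) ×ʳ 1#) * w * X j)
  next-suc j = begin
    X (2 ℕ.+ (d ℕ.+ j)) + X (suc j) + w * X j
      ≈⟨ solve 4 (λ s t u w → s :+ t :+ w :* u := s :+ (con 1 :* t :+ con 1 :* w :* u)) refl _ _ _ w ⟩
    X (2 ℕ.+ (d ℕ.+ j)) + (1# * X (suc j) + 1# * w * X j)
      ≈⟨ +-cong (reflexive (≡.cong (X ∘ suc) (≡.sym (ℕ.+-suc d j)))) (sym (conv-scaled-suc (λ _ → 1#) X j)) ⟩
    X (suc (d ℕ.+ suc j)) + conv (scaled (λ _ → 1#) 0) X (suc j)
      ≈⟨ next-+ (suc j) ⟩
    binomial 0 w (suc j) + conv (scaled (λ k → suc (d ℕ.+ k) ×ʳ 1#) 0) X (suc j)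
      ≈⟨ +-congˡ (conv-scaled-suc (λ k → suc (d ℕ.+ k) ×ʳ 1#) X j) ⟩
    binomial 0 w (suc j) + ((suc (d ℕ.+ 0) ×ʳ 1#) * X (suc j) + (suc (d ℕ.+ 1) ×ʳ 1#) * w * X j)
      ≡⟨ ≡.cong₂ (λ n m → binomial 0 w (suc j) + ((suc n ×ʳ 1#) * X (suc j) + (suc m ×ʳ 1#) * w * X j))
           (ℕ.+-identityʳ d) (ℕ.+-comm d 1) ⟩
    binomial 0 w (suc j) + ((suc d ×ʳ 1#) * X (suc j) + ((2 ℕ.+ d) ×ʳ 1#) * w * X j) ∎

  X-d+2 : 0 < d → X (2 ℕ.+ d) ≈ ((2 ℕ.+ d) ×ʳ 1#) * w
  X-d+2 0<d = +-cancelʳ w _ _ (begin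
    X (2 ℕ.+ d) + w
      ≈⟨ +-cong (reflexive (≡.cong (λ n → X (2 ℕ.+ n)) (≡.sym (ℕ.+-identityʳ d)))) refl ⟩
    X (2 ℕ.+ (d ℕ.+ 0)) + w
      ≈⟨ solve 2 (λ s w → s :+ w := s :+ con 0 :+ w :* con 1) refl _ w ⟩
    X (2 ℕ.+ (d ℕ.+ 0)) + 0# + w * 1#
      ≈⟨ +-congʳ (+-congˡ (sym (X-low 0<d))) ⟩
    X (2 ℕ.+ (d ℕ.+ 0)) + X 1 + w * X 0
      ≈⟨ next-suc 0 ⟩
    w + ((suc d ×ʳ 1#) * X 1 + ((2 ℕ.+ d) ×ʳ 1#) * w * 1#)
      ≈⟨ +-congˡ (+-congʳ (*-congˡ (X-low 0<d))) ⟩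
    w + ((suc d ×ʳ 1#) * 0# + ((2 ℕ.+ d) ×ʳ 1#) * w * 1#)
      ≈⟨ solve 3 (λ n m w → w :+ (n :* con 0 :+ m :* w :* con 1) := m :* w :+ w) refl _ ((2 ℕ.+ d) ×ʳ 1#) w ⟩
    ((2 ℕ.+ d) ×ʳ 1#) * w + w ∎)

  -- The linear recurrence of the denominator E - z E′ = 1 - d z^(d+1) - (d+1) w z^(d+2). From
  -- degree d + 3 on the numerator E contributes nothing.
  X-d+3 : ∀ j → X (3 ℕ.+ (d ℕ.+ j)) ≈ (d ×ʳ 1#) * X (2 ℕ.+ j) + (suc d ×ʳ 1#) * w * X (suc j)
  X-d+3 j = +-cancelʳ (X (2 ℕ.+ j) + w * X (suc j)) _ _ (begin
    X (3 ℕ.+ (d ℕ.+ j)) + (X (2 ℕ.+ j) + w * X (suc j))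
      ≈⟨ +-congʳ (reflexive (≡.cong (λ n → X (2 ℕ.+ n)) (≡.sym (ℕ.+-suc d j)))) ⟩
    X (2 ℕ.+ (d ℕ.+ suc j)) + (X (2 ℕ.+ j) + w * X (suc j))
      ≈⟨ sym (+-assoc _ _ _) ⟩
    X (2 ℕ.+ (d ℕ.+ suc j)) + X (2 ℕ.+ j) + w * X (suc j)
      ≈⟨ next-suc (suc j) ⟩
    0# + ((suc d ×ʳ 1#) * X (2 ℕ.+ j) + ((2 ℕ.+ d) ×ʳ 1#) * w * X (suc j))
      ≈⟨ solve 4 (λ n w s t → con 0 :+ ((con 1 :+ n) :* s :+ (con 1 :+ (con 1 :+ n)) :* w :* t)
                    := (n :* s :+ (con 1 :+ n) :* w :* t) :+ (s :+ w :* t)) refl (d ×ʳ 1#) w _ _ ⟩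
    (d ×ʳ 1#) * X (2 ℕ.+ j) + (suc d ×ʳ 1#) * w * X (suc j) + (X (2 ℕ.+ j) + w * X (suc j)) ∎)

-- Evaluation of symmetric functions

ℚ-ring : Ring₀
ℚ-ring = ℚ.+-*-commutativeRing

module ∑ℚ = Sums ℚ-ring

module _ where
  open ∑ℚ
  open CommutativeRing ℚ-ring using (_*_; *-cong; setoid)
  open NatSolver (CommutativeRing.commutativeSemiring ℚ-ring) using (solve; _:*_; _:=_)
  open SetoidReasoning setoid

  infix 4 _represents_
  -- A polynomial with natural coefficients as a multiset of exponent vectors. Unlike a coefficient
  -- function, a finite list can be evaluated at points of any ring.
  _represents_ : ∀ {N} → List (Vec ℕ N) → PowerSeries N → Set
  L represents f = ∀ α → f α ≡ ∑[ L ] λ β → (x^ β) α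

  below : ∀ {N} → Vec ℕ N → List (Vec ℕ N)
  below α = choices (Vec.map (λ a → upTo (suc a)) α)

  -- Since i stays at most a, the truncated a ∸ i is a true difference. The index i = b is out of
  -- range only for b > a, and then a = b + c is impossible as well.
  ∑-upTo-split : ∀ a b c →
    ∑ (upTo (suc a)) (λ i → 𝟙 (does (i ≟ b)) * 𝟙 (does (a ∸ i ≟ c))) ≡ 𝟙 (does (a ≟ b ℕ.+ c))
  ∑-upTo-split a b c with b ℕ.≤? a
  ... | yes b≤a = ≡.trans (∑-∈ _≟_ (upTo⁺ (suc a)) (∈-upTo⁺ (s≤s b≤a)) _) (≡.cong 𝟙 equivalent)
    where
    equivalent : does (a ∸ b ≟ c) ≡ does (a ≟ b ℕ.+ c)
    equivalent = does-⇔ (mk⇔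
      (λ a∸b≡c → ≡.trans (≡.sym (ℕ.m+[n∸m]≡n b≤a)) (≡.cong (b ℕ.+_) a∸b≡c))
      (λ a≡b+c → ≡.trans (≡.cong (_∸ b) a≡b+c) (ℕ.m+n∸m≡n b c)))
      (a ∸ b ≟ c) (a ≟ b ℕ.+ c)
  ... | no b≰a  = ≡.trans (∑-∉ _≟_ (λ b∈ → b≰a (ℕ.≤-pred (∈-upTo⁻ b∈))) _)
    (≡.cong 𝟙 (≡.sym (dec-false (a ≟ b ℕ.+ c) (λ a≡b+c → b≰a (ℕ.≤-trans (ℕ.m≤m+n b c) (ℕ.≤-reflexive (≡.sym a≡b+c)))))))

  x^-split : ∀ {N} (α β γ : Vec ℕ N) →
    ∑ (below α) (λ α′ → (x^ β) α′ * (x^ γ) (zipWith _∸_ α α′)) ≡ (x^ zipWith ℕ._+_ β γ) α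
  x^-split []      []      []      = ≡.refl
  x^-split (a ∷ α) (b ∷ β) (c ∷ γ) = begin
    ∑ (below (a ∷ α)) (λ α′ → (x^ (b ∷ β)) α′ * (x^ (c ∷ γ)) (zipWith _∸_ (a ∷ α) α′))
      ≡⟨ ∑-cartesianProductWith _∷_ (upTo (suc a)) (below α) _ ⟩
    ∑ (upTo (suc a)) (λ i → ∑ (below α) (λ α′ → (x^ (b ∷ β)) (i ∷ α′) * (x^ (c ∷ γ)) ((a ∸ i) ∷ zipWith _∸_ α α′)))
      ≡⟨ ∑-cong (upTo (suc a)) (λ i → ∑-cong (below α) (λ α′ → ≡.trans
           (*-cong (𝟙-∧ (does (i ≟ b)) (does (Vec-≡-dec _≟_ α′ β)))
                   (𝟙-∧ (does (a ∸ i ≟ c)) (does (Vec-≡-dec _≟_ (zipWith _∸_ α α′) γ))))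
           (solve 4 (λ p q r s → (p :* q) :* (r :* s) := (p :* r) :* (q :* s)) ≡.refl
             (𝟙 (does (i ≟ b))) ((x^ β) α′) (𝟙 (does (a ∸ i ≟ c))) ((x^ γ) (zipWith _∸_ α α′))))) ⟩
    ∑ (upTo (suc a)) (λ i → ∑ (below α) (λ α′ →
      (𝟙 (does (i ≟ b)) * 𝟙 (does (a ∸ i ≟ c))) * ((x^ β) α′ * (x^ γ) (zipWith _∸_ α α′))))
      ≡⟨ ∑-product (upTo (suc a)) (below α)
           (λ i → 𝟙 (does (i ≟ b)) * 𝟙 (does (a ∸ i ≟ c))) (λ α′ → (x^ β) α′ * (x^ γ) (zipWith _∸_ α α′)) ⟩
    ∑ (upTo (suc a)) (λ i → 𝟙 (does (i ≟ b)) * 𝟙 (does (a ∸ i ≟ c)))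
      * ∑ (below α) (λ α′ → (x^ β) α′ * (x^ γ) (zipWith _∸_ α α′))
      ≡⟨ ≡.cong₂ _*_ (∑-upTo-split a b c) (x^-split α β γ) ⟩
    𝟙 (does (a ≟ b ℕ.+ c)) * (x^ zipWith ℕ._+_ β γ) α
      ≡⟨ ≡.sym (𝟙-∧ (does (a ≟ b ℕ.+ c)) (does (Vec-≡-dec _≟_ α (zipWith ℕ._+_ β γ)))) ⟩
    (x^ zipWith ℕ._+_ (b ∷ β) (c ∷ γ)) (a ∷ α) ∎

  sums : ∀ {N} → List (Vec ℕ N) → List (Vec ℕ N) → List (Vec ℕ N)
  sums = cartesianProductWith (zipWith ℕ._+_)

  ⊛-represented : ∀ {N} {L M : List (Vec ℕ N)} {f g} → L represents f → M represents g → sums L M represents (f ⊛ g)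
  ⊛-represented {L = L} {M} {f} {g} L-f M-g α = begin
    ∑ (below α) (λ α′ → f α′ * g (zipWith _∸_ α α′))
      ≡⟨ ∑-cong (below α) (λ α′ → ≡.trans (≡.cong₂ _*_ (L-f α′) (M-g _))
           (≡.sym (∑-product L M (λ β → (x^ β) α′) (λ γ → (x^ γ) (zipWith _∸_ α α′))))) ⟩
    ∑ (below α) (λ α′ → ∑ L (λ β → ∑ M (λ γ → (x^ β) α′ * (x^ γ) (zipWith _∸_ α α′))))
      ≡⟨ ∑-swap (below α) L _ ⟩
    ∑ L (λ β → ∑ (below α) (λ α′ → ∑ M (λ γ → (x^ β) α′ * (x^ γ) (zipWith _∸_ α α′))))
      ≡⟨ ∑-cong L (λ β → ≡.trans (∑-swap (below α) M _) (∑-cong M (λ γ → x^-split α β γ))) ⟩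
    ∑ L (λ β → ∑ M (λ γ → (x^ zipWith ℕ._+_ β γ) α))
      ≡⟨ ≡.sym (∑-cartesianProductWith (zipWith ℕ._+_) L M _) ⟩
    ∑ (sums L M) (λ β → (x^ β) α) ∎

  squarefree : ∀ N → ℕ → List (Vec ℕ N)
  squarefree N k = filter (λ β → Vec.sum β ≟ k) (choices (Vec.replicate N (0 ∷ 1 ∷ [])))

  e-terms : ∀ N → List ℕ → List (Vec ℕ N)
  e-terms N = foldr (λ k → sums (squarefree N k)) (Vec.replicate N 0 ∷ [])

  e-represented : ∀ N μ → e-terms N μ represents e μ N
  e-represented N []      α = ≡.sym (ℚ.+-identityʳ _)
  e-represented N (k ∷ μ) = ⊛-represented {L = squarefree N k} {M = e-terms N μ} (λ _ → ≡.refl) (e-represented N μ)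

colourings : ∀ n N → List (Vec (Fin N) n)
colourings n N = choices (Vec.replicate n (allFin N))

module Monomials (R : Ring₀) where
  open CommutativeRing R hiding (zero)
  open Algebra.Properties.Semiring.Exp semiring using (^-homo-*) renaming (_^_ to _^ʳ_)
  open Elementary R
  open Sums R
  open SetoidReasoning setoid
  open NatSolver commutativeSemiring using (solve; _:*_; _:=_; con)

  monomial : ∀ {N} → (Fin N → Carrier) → Vec ℕ N → Carrier
  monomial x []      = 1#
  monomial x (a ∷ α) = x zero ^ʳ a * monomial (x ∘ suc) α

  monomial-0 : ∀ {N} (x : Fin N → Carrier) → monomial x (Vec.replicate N 0) ≈ 1#
  monomial-0 {zero}  x = refl
  monomial-0 {suc N} x = trans (*-identityˡ _) (monomial-0 (x ∘ suc))

  monomial-+ : ∀ {N} (x : Fin N → Carrier) α β →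
    monomial x (zipWith ℕ._+_ α β) ≈ monomial x α * monomial x β
  monomial-+ x []      []      = sym (*-identityˡ _)
  monomial-+ x (a ∷ α) (b ∷ β) = trans (*-cong (^-homo-* (x zero) a b) (monomial-+ (x ∘ suc) α β))
    (solve 4 (λ p q r s → (p :* q) :* (r :* s) := (p :* r) :* (q :* s)) refl _ _ _ _)

  ∑-squarefree : ∀ {N} (x : Fin N → Carrier) k → ∑ (squarefree N k) (monomial x) ≈ elem x k
  ∑-squarefree {N} x k = trans
    (∑-filter (λ β → Vec.sum β ≟ k) (choices (Vec.replicate N (0 ∷ 1 ∷ []))) (monomial x)) (go x k)
    where
    zeros-ones : ∀ N → List (Vec ℕ N)
    zeros-ones N = choices (Vec.replicate N (0 ∷ 1 ∷ []))

    term : ∀ {N} (x : Fin N → Carrier) k → Vec ℕ N → Carrier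
    term x k β = 𝟙 (does (Vec.sum β ≟ k)) * monomial x β

    expand : ∀ {N} (x : Fin (suc N) → Carrier) k → ∑ (zeros-ones (suc N)) (term x k)
      ≈ ∑ (zeros-ones N) (λ β → term x k (0 ∷ β)) + ∑ (zeros-ones N) (λ β → term x k (1 ∷ β))
    expand {N} x k = trans (∑-cartesianProductWith _∷_ (0 ∷ 1 ∷ []) (zeros-ones N) (term x k)) (+-congˡ (+-identityʳ _))

    go : ∀ {N} (x : Fin N → Carrier) k → ∑ (zeros-ones N) (term x k) ≈ elem x k
    go {zero}  x zero    = trans (+-identityʳ _) (*-identityˡ _)
    go {zero}  x (suc k) = trans (+-identityʳ _) (zeroˡ _)
    go {suc N} x zero    = begin
      ∑ (zeros-ones (suc N)) (term x 0)
        ≈⟨ expand x 0 ⟩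
      ∑ (zeros-ones N) (λ β → term x 0 (0 ∷ β)) + ∑ (zeros-ones N) (λ β → term x 0 (1 ∷ β))
        ≈⟨ +-cong (∑-cong (zeros-ones N) (λ β → *-congˡ {𝟙 (does (Vec.sum β ≟ 0))} (*-identityˡ (monomial (x ∘ suc) β))))
             (trans (∑-cong (zeros-ones N) (λ β → zeroˡ _)) (∑-0 (zeros-ones N))) ⟩
      ∑ (zeros-ones N) (term (x ∘ suc) 0) + 0#
        ≈⟨ trans (+-identityʳ _) (go (x ∘ suc) 0) ⟩
      elem x 0 ∎
    go {suc N} x (suc k) = begin
      ∑ (zeros-ones (suc N)) (term x (suc k))
        ≈⟨ expand x (suc k) ⟩
      ∑ (zeros-ones N) (λ β → term x (suc k) (0 ∷ β)) + ∑ (zeros-ones N) (λ β → term x (suc k) (1 ∷ β))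
        ≈⟨ +-cong
             (∑-cong (zeros-ones N) (λ β → *-congˡ {𝟙 (does (Vec.sum β ≟ suc k))} (*-identityˡ (monomial (x ∘ suc) β))))
             (∑-cong (zeros-ones N) (λ β → solve 3 (λ i y m → i :* ((y :* con 1) :* m) := y :* (i :* m)) refl
               (𝟙 (does (Vec.sum β ≟ k))) (x zero) (monomial (x ∘ suc) β))) ⟩
      ∑ (zeros-ones N) (term (x ∘ suc) (suc k)) + ∑ (zeros-ones N) (λ β → x zero * term (x ∘ suc) k β)
        ≈⟨ +-cong (go (x ∘ suc) (suc k)) (trans (∑-*ˡ (zeros-ones N) (x zero) _) (*-congˡ (go (x ∘ suc) k))) ⟩
      elem x (suc k) ∎

  elem-product : ∀ {N} → (Fin N → Carrier) → List ℕ → Carrier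
  elem-product x = foldr (λ k → elem x k *_) 1#

  ∑-e-terms : ∀ {N} (x : Fin N → Carrier) μ → ∑ (e-terms N μ) (monomial x) ≈ elem-product x μ
  ∑-e-terms x []      = trans (+-identityʳ _) (monomial-0 x)
  ∑-e-terms {N} x (k ∷ μ) = begin
    ∑ (sums (squarefree N k) (e-terms N μ)) (monomial x)
      ≈⟨ ∑-cartesianProductWith (zipWith ℕ._+_) (squarefree N k) (e-terms N μ) (monomial x) ⟩
    ∑ (squarefree N k) (λ β → ∑ (e-terms N μ) (λ γ → monomial x (zipWith ℕ._+_ β γ)))
      ≈⟨ ∑-cong (squarefree N k) (λ β → ∑-cong (e-terms N μ) (monomial-+ x β)) ⟩
    ∑ (squarefree N k) (λ β → ∑ (e-terms N μ) (λ γ → monomial x β * monomial x γ))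
      ≈⟨ ∑-product (squarefree N k) (e-terms N μ) (monomial x) (monomial x) ⟩
    ∑ (squarefree N k) (monomial x) * ∑ (e-terms N μ) (monomial x)
      ≈⟨ *-cong (∑-squarefree x k) (∑-e-terms x μ) ⟩
    elem x k * elem-product x μ ∎

  weight : ∀ {N n} → (Fin N → Carrier) → Vec (Fin N) n → Carrier
  weight x []      = 1#
  weight x (c ∷ κ) = x c * weight x κ

  monomial-increment : ∀ {N} (x : Fin N → Carrier) c (f g : Fin N → ℕ) →
    f c ≡ suc (g c) → (∀ i → i ≢ c → f i ≡ g i) →
    monomial x (tabulate f) ≈ x c * monomial x (tabulate g)
  monomial-increment x zero f g fc fi = begin
    x zero ^ʳ f zero * monomial (x ∘ suc) (tabulate (f ∘ suc))
      ≡⟨ ≡.cong₂ (λ a α → x zero ^ʳ a * monomial (x ∘ suc) α) fc (tabulate-cong (λ i → fi (suc i) λ ())) ⟩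
    (x zero * x zero ^ʳ g zero) * monomial (x ∘ suc) (tabulate (g ∘ suc))
      ≈⟨ *-assoc _ _ _ ⟩
    x zero * (x zero ^ʳ g zero * monomial (x ∘ suc) (tabulate (g ∘ suc))) ∎
  monomial-increment x (suc c) f g fc fi = begin
    x zero ^ʳ f zero * monomial (x ∘ suc) (tabulate (f ∘ suc))
      ≈⟨ *-cong (reflexive (≡.cong (x zero ^ʳ_) (fi zero λ ())))
           (monomial-increment (x ∘ suc) c (f ∘ suc) (g ∘ suc) fc (λ i i≢c → fi (suc i) (i≢c ∘ suc-injective))) ⟩
    x zero ^ʳ g zero * (x (suc c) * monomial (x ∘ suc) (tabulate (g ∘ suc)))
      ≈⟨ solve 3 (λ p q r → p :* (q :* r) := q :* (p :* r)) refl _ _ _ ⟩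
    x (suc c) * (x zero ^ʳ g zero * monomial (x ∘ suc) (tabulate (g ∘ suc))) ∎

  monomial-count : ∀ {N n} (x : Fin N → Carrier) (κ : Vec (Fin N) n) →
    monomial x (tabulate (λ i → count (i ≟ᶠ_) κ)) ≈ weight x κ
  monomial-count {zero}  x [] = refl
  monomial-count {suc N} x [] = trans (*-identityˡ _) (monomial-count (x ∘ suc) [])
  monomial-count x (c ∷ κ) = trans
    (monomial-increment x c (λ i → count (i ≟ᶠ_) (c ∷ κ)) (λ i → count (i ≟ᶠ_) κ) same other)
    (*-congˡ (monomial-count x κ))
    where
    same : count (c ≟ᶠ_) (c ∷ κ) ≡ suc (count (c ≟ᶠ_) κ)
    same rewrite dec-true (c ≟ᶠ c) ≡.refl = ≡.refl
    other : ∀ i → i ≢ c → count (i ≟ᶠ_) (c ∷ κ) ≡ count (i ≟ᶠ_) κ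
    other i i≢c rewrite dec-false (i ≟ᶠ c) i≢c = ≡.refl

module Evaluation (R : Ring₀) (ι : ℚ → Ring₀.Carrier R)
  (ι-homo : Morphisms.IsRingHomomorphism (Ring₀.rawRing ℚ-ring) (Ring₀.rawRing R) ι) where
  open CommutativeRing R hiding (zero)
  open Morphisms.IsRingHomomorphism ι-homo
  open Monomials R
  open Sums R
  open SetoidReasoning setoid

  ι-∑ : ∀ {X : Set} (xs : List X) f → ι (∑ℚ.∑ xs f) ≈ ∑ xs (ι ∘ f)
  ι-∑ []       f = 0#-homo
  ι-∑ (x ∷ xs) f = trans (+-homo _ _) (+-congˡ (ι-∑ xs f))

  ι-𝟙 : ∀ b → ι (∑ℚ.𝟙 b) ≈ 𝟙 b
  ι-𝟙 true  = 1#-homo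
  ι-𝟙 false = 0#-homo

  module _ {X : Set} (_≟ˣ_ : DecidableEquality X) (w : X → Carrier) where

    multiplicity : List X → X → ℚ
    multiplicity L α = ∑ℚ.∑ L (λ β → ∑ℚ.𝟙 (does (α ≟ˣ β)))

    ∑-collect : ∀ {D} → (∀ L → (∀ {β} → β ∈ L → β ∈ deduplicate _≟ˣ_ D) →
      ∑ L w ≈ ∑ (deduplicate _≟ˣ_ D) (λ α → ι (multiplicity L α) * w α))
    ∑-collect {D} L L⊆D = begin
      ∑ L w
        ≈⟨ ∑-cong-∈ L (λ β β∈ → sym (∑-∈ _≟ˣ_ (deduplicate-! _≟ˣ_ D) (L⊆D β∈) w)) ⟩
      ∑ L (λ β → ∑ D′ (λ α → 𝟙 (does (α ≟ˣ β)) * w α))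
        ≈⟨ ∑-swap L D′ _ ⟩
      ∑ D′ (λ α → ∑ L (λ β → 𝟙 (does (α ≟ˣ β)) * w α))
        ≈⟨ ∑-cong D′ (λ α → trans (∑-*ʳ L (w α) _) (*-congʳ (sym (trans (ι-∑ L _)
             (∑-cong L (λ β → ι-𝟙 (does (α ≟ˣ β)))))))) ⟩
      ∑ D′ (λ α → ι (multiplicity L α) * w α) ∎
      where D′ = deduplicate _≟ˣ_ D

    -- Equal coefficients give equal values: one duplicate-free list `D′` holds the exponents of all
    -- lists involved, and each sum is regrouped over it, with the multiplicities as coefficients.
    ∑-transfer : ∀ {M : Set} (L : List X) (μs : List M) (c : M → ℚ) (Lᴹ : M → List X) →
      (∀ α → multiplicity L α ≡ ∑ℚ.∑ μs (λ μ → c μ *ℚ multiplicity (Lᴹ μ) α)) →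
      ∑ L w ≈ ∑ μs (λ μ → ι (c μ) * ∑ (Lᴹ μ) w)
    ∑-transfer L μs c Lᴹ same = begin
      ∑ L w
        ≈⟨ ∑-collect L (λ β∈ → ∈-deduplicate⁺ _≟ˣ_ (∈-++⁺ˡ β∈)) ⟩
      ∑ D′ (λ α → ι (multiplicity L α) * w α)
        ≈⟨ ∑-cong D′ (λ α → trans
             (*-congʳ (trans (⟦⟧-cong (same α)) (trans (ι-∑ μs _) (∑-cong μs (λ μ → *-homo (c μ) _)))))
             (sym (∑-*ʳ μs (w α) _))) ⟩
      ∑ D′ (λ α → ∑ μs (λ μ → ι (c μ) * ι (multiplicity (Lᴹ μ) α) * w α))
        ≈⟨ ∑-swap D′ μs _ ⟩
      ∑ μs (λ μ → ∑ D′ (λ α → ι (c μ) * ι (multiplicity (Lᴹ μ) α) * w α))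
        ≈⟨ ∑-cong-∈ μs (λ μ μ∈ → trans (∑-cong D′ (λ α → *-assoc _ _ _))
             (trans (∑-*ˡ D′ (ι (c μ)) _) (*-congˡ (sym (∑-collect (Lᴹ μ)
               (λ β∈ → ∈-deduplicate⁺ _≟ˣ_ (∈-++⁺ʳ L (∈-concatMap⁺ Lᴹ (lose μ∈ β∈)))))))))  ⟩
      ∑ μs (λ μ → ι (c μ) * ∑ (Lᴹ μ) w) ∎
      where D′ = deduplicate _≟ˣ_ (L ++ concatMap Lᴹ μs)

  evaluate : ∀ (G : Graph) → let open Graph G in (c : List ℕ → ℚ) →
    (∀ N α → chromaticSymmetricFunction G N α ≡ ∑[ partitions order ] λ μ → c μ *ℚ e μ N α) →
    ∀ {N} (x : Fin N → Carrier) →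
    ∑ (colourings order N) (λ κ → 𝟙 (does (proper? G κ)) * weight x κ)
      ≈ ∑ (partitions order) (λ μ → ι (c μ) * elem-product x μ)
  evaluate G c expansion {N} x = begin
    ∑ (colourings order N) (λ κ → 𝟙 (does (proper? G κ)) * weight x κ)
      ≈⟨ sym (∑-filter (proper? G) (colourings order N) (weight x)) ⟩
    ∑ proper (weight x)
      ≈⟨ ∑-cong proper (λ κ → sym (monomial-count x κ)) ⟩
    ∑ proper (monomial x ∘ content G)
      ≡⟨ ≡.sym (∑-map proper (content G) (monomial x)) ⟩
    ∑ (map (content G) proper) (monomial x)
      ≈⟨ ∑-transfer (Vec-≡-dec _≟_) (monomial x) (map (content G) proper) (partitions order) c (e-terms N)
           (λ α → ≡.trans (∑ℚ.∑-map proper (content G) _) (≡.trans (expansion N α)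
             (∑ℚ.∑-cong (partitions order) (λ μ → ≡.cong (c μ *ℚ_) (e-represented N μ α))))) ⟩
    ∑ (partitions order) (λ μ → ι (c μ) * ∑ (e-terms N μ) (monomial x))
      ≈⟨ ∑-cong (partitions order) (λ μ → *-congˡ (∑-e-terms x μ)) ⟩
    ∑ (partitions order) (λ μ → ι (c μ) * elem-product x μ) ∎
    where
    open Graph G
    proper = filter (proper? G) (colourings order N)

-- Proper colourings of spiders, leg by leg

-- Here c colours the centre, p the last vertex visited on the current leg, and v the ℓ vertices that remain
-- on that leg, followed by the further legs.
module _ {N : ℕ} (c : Fin N) where

  ProperFrom : (p : Fin N) (ℓ : ℕ) (legs : List ℕ) → Vec (Fin N) (ℓ ℕ.+ sum legs) → Set
  ProperFrom p zero    []         v       = ⊤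
  ProperFrom p zero    (ℓ ∷ legs) v       = ProperFrom c ℓ legs v
  ProperFrom p (suc ℓ) legs       (y ∷ v) = p ≢ y × ProperFrom y ℓ legs v

  properFrom? : ∀ p ℓ legs v → Dec (ProperFrom p ℓ legs v)
  properFrom? p zero    []         v       = yes tt
  properFrom? p zero    (ℓ ∷ legs) v       = properFrom? c ℓ legs v
  properFrom? p (suc ℓ) legs       (y ∷ v) = ¬? (p ≟ᶠ y) ×-dec properFrom? y ℓ legs v

-- The edges of a leg one at a time, to match the recursion of `ProperFrom`; `legEdges` produces all
-- but the first by a single `map`.
strand : (p k ℓ : ℕ) → List (ℕ × ℕ)
strand p k zero    = []
strand p k (suc ℓ) = (p , suc k) ∷ strand (suc k) (suc k) ℓ

legEdges-strand : ∀ s ℓ → legEdges s ℓ ≡ strand 0 s ℓ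
legEdges-strand s zero    = ≡.refl
legEdges-strand s (suc ℓ) = ≡.cong ((0 , suc s) ∷_) (≡.trans (map-applyUpTo id _ ℓ) (go ℓ s _ (λ i → ≡.refl)))
  where
  go : ∀ ℓ s (h : ℕ → ℕ) → (∀ i → h i ≡ suc (s ℕ.+ i)) →
    applyUpTo (λ i → (h i , suc (h i))) ℓ ≡ strand (suc s) (suc s) ℓ
  go zero    s h h≡ = ≡.refl
  go (suc ℓ) s h h≡ = ≡.cong₂ _∷_
    (≡.cong (λ n → (n , suc n)) (≡.trans (h≡ 0) (≡.cong suc (ℕ.+-identityʳ s))))
    (go ℓ (suc s) (h ∘ suc) (λ i → ≡.trans (h≡ (suc i)) (≡.cong suc (ℕ.+-suc s i))))

module _ {N n : ℕ} (κ : Vec (Fin N) n) where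

  -- Edges are pairs of natural numbers, so the vertices are reached through `toℕ`; lists of edges
  -- can then be traversed without carrying bounds.
  Bichromatic : ℕ × ℕ → Set
  Bichromatic (i , j) = ∀ u v → toℕ u ≡ i → toℕ v ≡ j → lookup κ u ≢ lookup κ v

  HasColour : ℕ → Fin N → Set
  HasColour i y = Σ[ u ∈ Fin n ] toℕ u ≡ i × lookup κ u ≡ y

  bichromatic⇔≢ : ∀ {i j y z} → HasColour i y → HasColour j z → Bichromatic (i , j) ⇔ y ≢ z
  bichromatic⇔≢ (u , ≡.refl , ≡.refl) (v , ≡.refl , ≡.refl) = mk⇔
    (λ bi → bi u v ≡.refl ≡.refl)
    (λ y≢z u′ v′ u′≡u v′≡v κu′≡κv′ → y≢z (≡.subst₂ (λ u v → lookup κ u ≡ lookup κ v)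
      (toℕ-injective u′≡u) (toℕ-injective v′≡v) κu′≡κv′))

  -- Induction along the edges in their listed order. The invariant is that the first k vertices
  -- after the centre are done, so `v` starts with the colour of vertex k + 1.
  bichromatic⇔properFrom : ∀ {c p y} k ℓ legs (v : Vec (Fin N) (ℓ ℕ.+ sum legs)) →
    HasColour 0 c → HasColour p y → (∀ i → HasColour (suc (k ℕ.+ toℕ i)) (lookup v i)) →
    All Bichromatic (strand p k ℓ ++ spiderEdges (k ℕ.+ ℓ) legs) ⇔ ProperFrom c y ℓ legs v
  bichromatic⇔properFrom k zero [] v c-col p-col v-col = mk⇔ (λ _ → tt) (λ _ → [])
  bichromatic⇔properFrom {c} k zero (ℓ ∷ legs) v c-col p-col v-col
    rewrite ℕ.+-identityʳ k | legEdges-strand k ℓ = bichromatic⇔properFrom k ℓ legs v c-col c-col v-col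
  bichromatic⇔properFrom {p = p} k (suc ℓ) legs (z ∷ v) c-col p-col v-col rewrite ℕ.+-suc k ℓ = mk⇔
    (λ { (bi ∷ bis) → first.to bi , rest.to bis })
    (λ { (y≢z , ok) → first.from y≢z ∷ rest.from ok })
    where
    z-col : HasColour (suc k) z
    z-col = ≡.subst (λ m → HasColour (suc m) z) (ℕ.+-identityʳ k) (v-col zero)
    module first = Equivalence (bichromatic⇔≢ p-col z-col)
    module rest = Equivalence (bichromatic⇔properFrom (suc k) ℓ legs v c-col z-col
      (λ i → ≡.subst (λ m → HasColour (suc m) (lookup v i)) (ℕ.+-suc k (toℕ i)) (v-col (suc i))))

spider-proper : ∀ {N} legs (c : Fin N) v → Proper (spider legs) (c ∷ v) ⇔ ProperFrom c c 0 legs v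
spider-proper legs c v = mk⇔
  (λ proper → E.to (All.tabulate (λ { {i , j} ij∈ u w ≡.refl ≡.refl → proper u w (inj₁ ij∈) })))
  (λ ok → λ { u w (inj₁ uw∈) → All.lookup (E.from ok) uw∈ u w ≡.refl ≡.refl
            ; u w (inj₂ wu∈) → All.lookup (E.from ok) wu∈ w u ≡.refl ≡.refl ∘ ≡.sym })
  where
  c-col : HasColour (c ∷ v) 0 c
  c-col = zero , ≡.refl , ≡.refl
  module E = Equivalence (bichromatic⇔properFrom (c ∷ v) 0 0 legs v c-col c-col (λ i → suc i , ≡.refl , ≡.refl))

module SpiderSums (R : Ring₀) {N} (x : Fin N → Ring₀.Carrier R) where
  open CommutativeRing R hiding (zero)
  open Sums R
  open PathSums R x
  open Monomials R
  open SetoidReasoning setoid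
  open NatSolver commutativeSemiring using (solve; _:*_; _:=_)

  legs-product : Fin N → List ℕ → Carrier
  legs-product c []         = 1#
  legs-product c (ℓ ∷ legs) = P c ℓ * legs-product c legs

  -- Once the centre has its colour, the legs are coloured independently, so the sum factors.
  ∑-properFrom : ∀ c p ℓ legs →
    ∑ (colourings (ℓ ℕ.+ sum legs) N) (λ v → 𝟙 (does (properFrom? c p ℓ legs v)) * weight x v)
      ≈ P p ℓ * legs-product c legs
  ∑-properFrom c p zero    []         = +-identityʳ _
  ∑-properFrom c p zero    (ℓ ∷ legs) = trans (∑-properFrom c c ℓ legs) (sym (*-identityˡ _))
  ∑-properFrom c p (suc ℓ) legs       = begin
    ∑ (colourings (suc (ℓ ℕ.+ sum legs)) N) (λ v → 𝟙 (does (properFrom? c p (suc ℓ) legs v)) * weight x v)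
      ≈⟨ ∑-cartesianProductWith _∷_ (allFin N) vs _ ⟩
    ∑ᶜ (λ y → ∑ vs (λ v → 𝟙 (does (¬? (p ≟ᶠ y) ×-dec properFrom? c y ℓ legs v)) * (x y * weight x v)))
      ≈⟨ ∑-cong (allFin N) (λ y → trans
           (∑-cong vs (λ v → trans
             (*-congʳ (𝟙-∧ (does (¬? (p ≟ᶠ y))) (does (properFrom? c y ℓ legs v))))
             (solve 4 (λ s t u w → (s :* t) :* (u :* w) := (s :* u) :* (t :* w)) refl
               (𝟙 (does (¬? (p ≟ᶠ y)))) (𝟙 (does (properFrom? c y ℓ legs v))) (x y) (weight x v))))
           (trans (∑-*ˡ vs (𝟙 (does (¬? (p ≟ᶠ y))) * x y) _)
             (trans (*-congˡ (∑-properFrom c y ℓ legs))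
               (solve 4 (λ s t u w → (s :* t) :* (u :* w) := (s :* (t :* u)) :* w) refl
                 (𝟙 (does (¬? (p ≟ᶠ y)))) (x y) (P y ℓ) (legs-product c legs))))) ⟩
    ∑ᶜ (λ y → 𝟙 (does (¬? (p ≟ᶠ y))) * (x y * P y ℓ) * legs-product c legs)
      ≈⟨ ∑-*ʳ (allFin N) (legs-product c legs) _ ⟩
    P p (suc ℓ) * legs-product c legs ∎
    where vs = colourings (ℓ ℕ.+ sum legs) N

  ∑-spider : ∀ legs →
    ∑ (colourings (suc (sum legs)) N) (λ κ → 𝟙 (does (proper? (spider legs) κ)) * weight x κ)
      ≈ ∑ᶜ (λ c → x c * legs-product c legs)
  ∑-spider legs = begin
    ∑ (colourings (suc (sum legs)) N) (λ κ → 𝟙 (does (proper? (spider legs) κ)) * weight x κ)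
      ≈⟨ ∑-cartesianProductWith _∷_ (allFin N) vs _ ⟩
    ∑ᶜ (λ c → ∑ vs (λ v → 𝟙 (does (proper? (spider legs) (c ∷ v))) * (x c * weight x v)))
      ≈⟨ ∑-cong (allFin N) (λ c → trans
           (∑-cong vs (λ v → trans
             (*-congʳ (reflexive (≡.cong 𝟙
               (does-⇔ (spider-proper legs c v) (proper? (spider legs) (c ∷ v)) (properFrom? c c 0 legs v)))))
             (solve 3 (λ s t u → s :* (t :* u) := t :* (s :* u)) refl
               (𝟙 (does (properFrom? c c 0 legs v))) (x c) (weight x v))))
           (trans (∑-*ˡ vs (x c) _) (*-congˡ (trans (∑-properFrom c c 0 legs) (*-identityˡ _))))) ⟩
    ∑ᶜ (λ c → x c * legs-product c legs) ∎
    where vs = colourings (sum legs) N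

  spider-ab2 : ∀ a b → let S = ∑ᶜ (λ c → x c * legs-product c (a ∷ b ∷ 2 ∷ [])) in
    S + (X (suc a) * X (2 ℕ.+ b) + X (2 ℕ.+ a) * X (suc b))
      ≈ X (3 ℕ.+ (a ℕ.+ b)) + (X 1 * X (2 ℕ.+ (a ℕ.+ b)) + X 2 * X (suc (a ℕ.+ b)))
  spider-ab2 a b = trans
    (+-congʳ (∑-cong (allFin N) (λ c → *-congˡ {x c} (*-congˡ {P c a} (*-congˡ {P c b} (*-identityʳ (P c 2)))))))
    (spider-paths a b)

-- Dual numbers and nonnegativity

-- (p , q) stands for p + q ε with ε² = 0.
Dual : Set
Dual = ℚ × ℚ

module _ where
  open CommutativeRing ℚ-ring using (commutativeSemiring; +-abelianGroup; *-comm; *-identityˡ; *-identityʳ)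
  open NatSolver commutativeSemiring using (solve; _:+_; _:*_; _:=_; con)

  infixl 6 _+ᴰ_
  infixl 7 _*ᴰ_
  _+ᴰ_ _*ᴰ_ : Dual → Dual → Dual
  (p , q) +ᴰ (r , s) = p +ℚ r , q +ℚ s
  (p , q) *ᴰ (r , s) = p *ℚ r , p *ℚ s +ℚ q *ℚ r

  dual-isCommutativeRing : IsCommutativeRing (Pointwise _≡_ _≡_) _+ᴰ_ _*ᴰ_ (λ (p , q) → -ℚ p , -ℚ q) (0ℚ , 0ℚ) (1ℚ , 0ℚ)
  dual-isCommutativeRing = record
    { isRing = record
      { +-isAbelianGroup = AbelianGroup.isAbelianGroup (DirectProduct.abelianGroup +-abelianGroup +-abelianGroup)
      ; *-cong = λ (p , p′) (q , q′) → ≡.cong₂ _*ℚ_ p q , ≡.cong₂ _+ℚ_ (≡.cong₂ _*ℚ_ p q′) (≡.cong₂ _*ℚ_ p′ q)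
      ; *-assoc = λ (p , p′) (q , q′) (r , r′) →
            solve 3 (λ p q r → (p :* q) :* r := p :* (q :* r)) ≡.refl p q r
          , solve 6 (λ p p′ q q′ r r′ → (p :* q) :* r′ :+ (p :* q′ :+ p′ :* q) :* r
                      := p :* (q :* r′ :+ q′ :* r) :+ p′ :* (q :* r)) ≡.refl p p′ q q′ r r′
      ; *-identity =
          (λ (p , p′) → *-identityˡ p , solve 2 (λ p p′ → con 1 :* p′ :+ con 0 :* p := p′) ≡.refl p p′)
        , (λ (p , p′) → *-identityʳ p , solve 2 (λ p p′ → p :* con 0 :+ p′ :* con 1 := p′) ≡.refl p p′)
      ; distrib =
          (λ (p , p′) (q , q′) (r , r′) →
              solve 3 (λ p q r → p :* (q :+ r) := p :* q :+ p :* r) ≡.refl p q r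
            , solve 6 (λ p p′ q q′ r r′ → p :* (q′ :+ r′) :+ p′ :* (q :+ r)
                := (p :* q′ :+ p′ :* q) :+ (p :* r′ :+ p′ :* r)) ≡.refl p p′ q q′ r r′)
        , (λ (p , p′) (q , q′) (r , r′) →
              solve 3 (λ p q r → (q :+ r) :* p := q :* p :+ r :* p) ≡.refl p q r
            , solve 6 (λ p p′ q q′ r r′ → (q :+ r) :* p′ :+ (q′ :+ r′) :* p
                := (q :* p′ :+ q′ :* p) :+ (r :* p′ :+ r′ :* p)) ≡.refl p p′ q q′ r r′)
      }
    ; *-comm = λ (p , p′) (q , q′) → *-comm p q ,
        solve 4 (λ p p′ q q′ → p :* q′ :+ p′ :* q := q :* p′ :+ q′ :* p) ≡.refl p p′ q q′
    }

dual-ring : Ring₀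
dual-ring = record { isCommutativeRing = dual-isCommutativeRing }

constant : ℚ → Dual
constant p = p , 0ℚ

ε : Dual
ε = 0ℚ , 1ℚ

constant-homo : Morphisms.IsRingHomomorphism (Ring₀.rawRing ℚ-ring) (Ring₀.rawRing dual-ring) constant
constant-homo = record
  { isSemiringHomomorphism = record
    { isNearSemiringHomomorphism = record
      { +-isMonoidHomomorphism = record
        { isMagmaHomomorphism = record
          { isRelHomomorphism = record { cong = λ p≡q → p≡q , ≡.refl }
          ; homo = λ _ _ → ≡.refl , ≡.refl
          }
        ; ε-homo = ≡.refl , ≡.refl
        }
      ; *-homo = λ p q → ≡.refl , solve 2 (λ p q → con 0 := p :* con 0 :+ con 0 :* q) ≡.refl p q
      }
    ; 1#-homo = ≡.refl , ≡.refl
    }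
  ; -‿homo = λ _ → ≡.refl , ≡.refl
  }
  where open NatSolver (CommutativeRing.commutativeSemiring ℚ-ring) using (solve; _:+_; _:*_; _:=_; con)

module _ where
  -- Coefficientwise rather than lexicographic: it is closed under sums and products, and an
  -- inequality can be read off from either coordinate.
  NonNeg : Dual → Set
  NonNeg (p , q) = 0ℚ ≤ℚ p × 0ℚ ≤ℚ q

  0≤+ : ∀ {p q} → 0ℚ ≤ℚ p → 0ℚ ≤ℚ q → 0ℚ ≤ℚ p +ℚ q
  0≤+ = ℚ.+-mono-≤

  0≤* : ∀ {p q} → 0ℚ ≤ℚ p → 0ℚ ≤ℚ q → 0ℚ ≤ℚ p *ℚ q
  0≤* {p} {q} 0≤p 0≤q = ℚ.nonNegative⁻¹ (p *ℚ q) {{ℚ.nonNeg*nonNeg⇒nonNeg p {{nonNegative 0≤p}} q {{nonNegative 0≤q}}}}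

  nonNeg-0 : NonNeg (0ℚ , 0ℚ)
  nonNeg-0 = ℚ.≤-refl , ℚ.≤-refl

  nonNeg-1 : NonNeg (1ℚ , 0ℚ)
  nonNeg-1 = ℚ.nonNegative⁻¹ 1ℚ , ℚ.≤-refl

  nonNeg-ε : NonNeg ε
  nonNeg-ε = ℚ.≤-refl , ℚ.nonNegative⁻¹ 1ℚ

  nonNeg-+ : ∀ {s t} → NonNeg s → NonNeg t → NonNeg (s +ᴰ t)
  nonNeg-+ (p , p′) (q , q′) = 0≤+ p q , 0≤+ p′ q′

  nonNeg-* : ∀ {s t} → NonNeg s → NonNeg t → NonNeg (s *ᴰ t)
  nonNeg-* (p , p′) (q , q′) = 0≤* p q , 0≤+ (0≤* p q′) (0≤* p′ q)

  open Algebra.Properties.Semiring.Mult (CommutativeRing.semiring ℚ-ring) using () renaming (_×_ to _×ℚ_)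
  open Algebra.Properties.Semiring.Mult (CommutativeRing.semiring dual-ring) using () renaming (_×_ to _×ᴰ_)

  0≤n×1 : ∀ n → 0ℚ ≤ℚ n ×ℚ 1ℚ
  0≤n×1 zero    = ℚ.≤-refl
  0≤n×1 (suc n) = 0≤+ (proj₁ nonNeg-1) (0≤n×1 n)

  ×-cancel-≤ : ∀ m n {s} → 0ℚ ≤ℚ s → s +ℚ m ×ℚ 1ℚ ≡ n ×ℚ 1ℚ → m ℕ.≤ n
  ×-cancel-≤ zero    n       0≤s eq = z≤n
  ×-cancel-≤ (suc m) zero    {s} 0≤s eq = contradiction
    (ℚ.≤-trans (ℚ.+-mono-≤ {0ℚ} {s} 0≤s (ℚ.+-mono-≤ {1ℚ} {1ℚ} ℚ.≤-refl (0≤n×1 m))) (ℚ.≤-reflexive eq))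
    -- The left side 0 + (1 + 0) is closed and computes to 1, so 1 ≤ 0 is refuted by evaluation.
    (λ { (*≤* (+≤+ ())) })
  ×-cancel-≤ (suc m) (suc n) {s} 0≤s eq = s≤s (×-cancel-≤ m n 0≤s (+-cancelˡ 1ℚ _ _
    (≡.trans (solve 3 (λ a s t → a :+ (s :+ t) := s :+ (a :+ t)) ≡.refl 1ℚ s (m ×ℚ 1ℚ)) eq)))
    where
    open Algebra.Properties.Ring (CommutativeRing.ring ℚ-ring) using (+-cancelˡ)
    open NatSolver (CommutativeRing.commutativeSemiring ℚ-ring) using (solve; _:+_; _:=_)

  open CommutativeRing dual-ring using () renaming (_≈_ to _≈ᴰ_)

  ×ᴰ-constant : ∀ n → n ×ᴰ (1ℚ , 0ℚ) ≡ constant (n ×ℚ 1ℚ)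
  ×ᴰ-constant zero    = ≡.refl
  ×ᴰ-constant (suc n) = ≡.cong ((1ℚ , 0ℚ) +ᴰ_) (×ᴰ-constant n)

  1-cancel-≤ : ∀ m n {s} → NonNeg s → s +ᴰ (m ×ᴰ (1ℚ , 0ℚ)) ≈ᴰ n ×ᴰ (1ℚ , 0ℚ) → m ℕ.≤ n
  1-cancel-≤ m n (0≤s , _) eq rewrite ×ᴰ-constant m | ×ᴰ-constant n = ×-cancel-≤ m n 0≤s (proj₁ eq)

  ε-cancel-≤ : ∀ m n {s} → NonNeg s → s +ᴰ (m ×ᴰ (1ℚ , 0ℚ)) *ᴰ ε ≈ᴰ (n ×ᴰ (1ℚ , 0ℚ)) *ᴰ ε → m ℕ.≤ n
  ε-cancel-≤ m n {s} (_ , 0≤s) eq rewrite ×ᴰ-constant m | ×ᴰ-constant n = ×-cancel-≤ m n 0≤s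
    (≡.trans (≡.cong (proj₂ s +ℚ_) (≡.sym (coefficient (m ×ℚ 1ℚ))))
      (≡.trans (proj₂ eq) (coefficient (n ×ℚ 1ℚ))))
    where
    open NatSolver (CommutativeRing.commutativeSemiring ℚ-ring) using (solve; _:+_; _:*_; _:=_; con)
    coefficient : ∀ p → p *ℚ 1ℚ +ℚ 0ℚ *ℚ 0ℚ ≡ p
    coefficient = solve 1 (λ p → p :* con 1 :+ con 0 :* con 0 := p) ≡.refl

-- Values of an e-positive spider

-- At the points x the value of e_{d+1} is 1, that of e_{d+2} is w, and all other e_k vanish.
module Valuation (d : ℕ) (w : Dual) (E : Extension dual-ring)
  (x : Fin (2 ℕ.+ d) → Ring₀.Carrier (Extension.ring E))
  (elem-x : ∀ k → Ring₀._≈_ (Extension.ring E) (Elementary.elem (Extension.ring E) x k)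
                                (Extension.ι E (Coefficients.trinomial dual-ring d w k))) where
  open Extension E public
  open CommutativeRing ring hiding (zero; ring) public
  module ι = Morphisms.IsRingMonomorphism mono
  open Algebra.Properties.Ring (Ring₀.ring ring) public using (+-cancelʳ)
  open Algebra.Properties.Semiring.Mult semiring public using (×1-homo-*; ×-homo-+) renaming (_×_ to _×ʳ_)
  open Algebra.Properties.Semiring.Mult (CommutativeRing.semiring dual-ring) using () renaming (_×_ to _×ᴰ_)
  open Sums ring public
  open Elementary ring using (elem)
  open Coefficients dual-ring using () renaming (trinomial to trinomialᴰ; binomial to binomialᴰ)
  open Coefficients ring using (trinomial; binomial)
  open PathSums ring x public using (X; ∑ᶜ)

  ι-binomial : ∀ d k → ι (binomialᴰ d w k) ≈ binomial d (ι w) k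
  ι-binomial zero    zero          = ι.1#-homo
  ι-binomial zero    (suc zero)    = refl
  ι-binomial zero    (suc (suc _)) = ι.0#-homo
  ι-binomial (suc d) zero          = ι.0#-homo
  ι-binomial (suc d) (suc k)       = ι-binomial d k

  ι-trinomial : ∀ k → ι (trinomialᴰ d w k) ≈ trinomial d (ι w) k
  ι-trinomial zero    = ι.1#-homo
  ι-trinomial (suc k) = ι-binomial d k

  open SparsePaths ring x d (ι w) (λ k → trans (elem-x k) (ι-trinomial k)) public
    using (X-low; X-d+1; X-d+2; X-d+3)

  ν : ℕ → Carrier
  ν n = n ×ʳ 1#

  ι-ν : ∀ n → ι (n ×ᴰ (1ℚ , 0ℚ)) ≈ ν n
  ι-ν zero    = ι.0#-homo
  ι-ν (suc n) = trans (ι.+-homo _ _) (+-cong ι.1#-homo (ι-ν n))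

  open Evaluation ring (ι ∘ constant)
    (Composition.isRingHomomorphism trans constant-homo ι.isRingHomomorphism) using (evaluate)
  open Monomials ring using (elem-product)

  module _ (w≥0 : NonNeg w) where

    binomial≥0 : ∀ d k → NonNeg (binomialᴰ d w k)
    binomial≥0 zero    zero          = nonNeg-1
    binomial≥0 zero    (suc zero)    = w≥0
    binomial≥0 zero    (suc (suc _)) = nonNeg-0
    binomial≥0 (suc d) zero          = nonNeg-0
    binomial≥0 (suc d) (suc k)       = binomial≥0 d k

    trinomial≥0 : ∀ k → NonNeg (trinomialᴰ d w k)
    trinomial≥0 zero    = nonNeg-1
    trinomial≥0 (suc k) = binomial≥0 d k

    -- In place of an order on the extension, an element counts as nonnegative if it is the image of
    -- a nonnegative dual number.
    elem-product≥0 : ∀ μ → Σ[ s ∈ Dual ] NonNeg s × elem-product x μ ≈ ι s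
    elem-product≥0 []      = (1ℚ , 0ℚ) , nonNeg-1 , sym ι.1#-homo
    elem-product≥0 (k ∷ μ) with elem-product≥0 μ
    ... | s , s≥0 , μ≈s = trinomialᴰ d w k *ᴰ s , nonNeg-* (trinomial≥0 k) s≥0 ,
      trans (*-cong (elem-x k) μ≈s) (sym (ι.*-homo _ s))

    ∑≥0 : ∀ {M : Set} (μs : List M) (f : M → Carrier) →
      (∀ μ → μ ∈ μs → Σ[ s ∈ Dual ] NonNeg s × f μ ≈ ι s) → Σ[ s ∈ Dual ] NonNeg s × ∑ μs f ≈ ι s
    ∑≥0 []       f f≥0 = (0ℚ , 0ℚ) , nonNeg-0 , sym ι.0#-homo
    ∑≥0 (μ ∷ μs) f f≥0 with f≥0 μ (here ≡.refl) | ∑≥0 μs f (λ μ′ → f≥0 μ′ ∘ there)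
    ... | s , s≥0 , μ≈s | t , t≥0 , μs≈t =
      s +ᴰ t , nonNeg-+ s≥0 t≥0 , trans (+-cong μ≈s μs≈t) (sym (ι.+-homo s t))

    spider≥0 : ∀ legs → IsEPositive (spider legs) →
      Σ[ s ∈ Dual ] NonNeg s × ∑ᶜ (λ c → x c * SpiderSums.legs-product ring x c legs) ≈ ι s
    spider≥0 legs (c , c≥0 , expansion) =
      let (s , s≥0 , sum≈s) = ∑≥0 (partitions (Graph.order (spider legs))) (λ μ → ι (constant (c μ)) * elem-product x μ)
            (λ μ μ∈ → let (t , t≥0 , μ≈t) = elem-product≥0 μ in
              constant (c μ) *ᴰ t , nonNeg-* (c≥0 μ μ∈ , ℚ.≤-refl) t≥0 ,
              trans (*-congˡ μ≈t) (sym (ι.*-homo _ t)))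
      in s , s≥0 , trans (sym (SpiderSums.∑-spider ring x legs)) (trans (evaluate (spider legs) c expansion x) sum≈s)

    -- From d ≥ 2 it follows that X_1 = X_2 = 0, so both positive products with these factors
    -- disappear and X_n alone must outweigh the negative ones.
    spider-ab2≥0 : ∀ {a b} → 2 ℕ.≤ d → IsEPositive (spider (a ∷ b ∷ 2 ∷ [])) →
      Σ[ s ∈ Dual ] NonNeg s ×
        ι s + (X (suc a) * X (2 ℕ.+ b) + X (2 ℕ.+ a) * X (suc b)) ≈ X (3 ℕ.+ (a ℕ.+ b))
    spider-ab2≥0 {a} {b} 2≤d e-pos =
      let (s , s≥0 , S≈s) = spider≥0 (a ∷ b ∷ 2 ∷ []) e-pos in s , s≥0 , value S≈s
      where
      open SetoidReasoning setoid
      value : ∀ {s} → ∑ᶜ (λ c → x c * SpiderSums.legs-product ring x c (a ∷ b ∷ 2 ∷ [])) ≈ ι s →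
        ι s + (X (suc a) * X (2 ℕ.+ b) + X (2 ℕ.+ a) * X (suc b)) ≈ X (3 ℕ.+ (a ℕ.+ b))
      value {s} S≈s = begin
        ι s + (X (suc a) * X (2 ℕ.+ b) + X (2 ℕ.+ a) * X (suc b))
          ≈⟨ +-congʳ (sym S≈s) ⟩
        ∑ᶜ (λ c → x c * SpiderSums.legs-product ring x c (a ∷ b ∷ 2 ∷ []))
          + (X (suc a) * X (2 ℕ.+ b) + X (2 ℕ.+ a) * X (suc b))
          ≈⟨ SpiderSums.spider-ab2 ring x a b ⟩
        X (3 ℕ.+ (a ℕ.+ b)) + (X 1 * X (2 ℕ.+ (a ℕ.+ b)) + X 2 * X (suc (a ℕ.+ b)))
          ≈⟨ +-congˡ (trans (+-cong
               (trans (*-congʳ (X-low (ℕ.≤-trans (s≤s z≤n) 2≤d))) (zeroˡ _))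
               (trans (*-congʳ (X-low 2≤d)) (zeroˡ _))) (+-identityˡ _)) ⟩
        X (3 ℕ.+ (a ℕ.+ b)) + 0#
          ≈⟨ +-identityʳ _ ⟩
        X (3 ℕ.+ (a ℕ.+ b)) ∎

trinomial-valuation : ∀ d w → Σ[ E ∈ Extension dual-ring ] let open Extension E in
  Σ[ x ∈ (Fin (2 ℕ.+ d) → Ring₀.Carrier ring) ]
    ∀ k → Ring₀._≈_ ring (Elementary.elem ring x k) (ι (Coefficients.trinomial dual-ring d w k))
trinomial-valuation d w = splitting (2 ℕ.+ d) dual-ring (trinomial d w) (CommutativeRing.refl dual-ring)
  (λ { (suc k) (s≤s d<k) → CommutativeRing.reflexive dual-ring (binomial-high d w d<k) })
  where open Coefficients dual-ring

-- The intervals for a, from e_{b+1} = e_{b+2} = 1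

module _ (a b : ℕ) (2≤b : 2 ℕ.≤ b) (e-pos : IsEPositive (spider (a ∷ b ∷ 2 ∷ [])))
  (E : Extension dual-ring) (x : Fin (2 ℕ.+ b) → Ring₀.Carrier (Extension.ring E))
  (elem-x : ∀ k → Ring₀._≈_ (Extension.ring E) (Elementary.elem (Extension.ring E) x k)
                                (Extension.ι E (Coefficients.trinomial dual-ring b (1ℚ , 0ℚ) k))) where
  open Valuation b (1ℚ , 0ℚ) E x elem-x
  open SetoidReasoning setoid
  open NatSolver commutativeSemiring using (solve; _:+_; _:*_; _:=_; con)

  0<b : 0 < b
  0<b = ℕ.≤-trans (s≤s z≤n) 2≤b

  X-next : ∀ j → X (3 ℕ.+ (b ℕ.+ j)) ≈ ν b * X (2 ℕ.+ j) + ν (suc b) * X (suc j)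
  X-next j = trans (X-d+3 j) (+-congˡ (*-congʳ (trans (*-congˡ ι.1#-homo) (*-identityʳ _))))

  record Natural (r : Carrier) : Set where
    constructor _,_
    field
      value  : ℕ
      equals : r ≈ ν value

  record Positive (r : Carrier) : Set where
    constructor _,_
    field
      predecessor : ℕ
      equals      : r ≈ ν (suc predecessor)

  positive-+ : ∀ {r s} → Positive r → Natural s → Positive (r + s)
  positive-+ (m , r≈m) (n , s≈n) = m ℕ.+ n , trans (+-cong r≈m s≈n) (sym (×-homo-+ 1# (suc m) n))

  natural-+ : ∀ {r s} → Natural r → Natural s → Natural (r + s)
  natural-+ (m , r≈m) (n , s≈n) = m ℕ.+ n , trans (+-cong r≈m s≈n) (sym (×-homo-+ 1# m n))

  natural-* : ∀ m {r} → Natural r → Natural (ν m * r)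
  natural-* m (n , r≈n) = m ℕ.* n , trans (*-congˡ r≈n) (sym (×1-homo-* m n))

  positive-* : ∀ m {r} → 0 < m → Positive r → Positive (ν m * r)
  positive-* (suc m) _ (n , r≈n) = n ℕ.+ m ℕ.* suc n , trans (*-congˡ r≈n) (sym (×1-homo-* (suc m) (suc n)))

  positive⇒natural : ∀ {r} → Positive r → Natural r
  positive⇒natural (n , r≈n) = suc n , r≈n

  positive-resp : ∀ {r s} → r ≈ s → Positive s → Positive r
  positive-resp r≈s (n , s≈n) = n , trans r≈s s≈n

  positive-b+1 : Positive (X (suc b))
  positive-b+1 = b , X-d+1

  positive-b+2 : Positive (X (2 ℕ.+ b))
  positive-b+2 = suc b , trans (X-d+2 0<b) (trans (*-congˡ ι.1#-homo) (*-identityʳ _))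

  natural-X : ∀ m → Natural (X m)
  natural-X = <-rec _ go
    where
    from-b : ∀ j → (∀ {i} → i < suc (b ℕ.+ j) → Natural (X i)) → Natural (X (suc (b ℕ.+ j)))
    from-b zero          rec rewrite ℕ.+-identityʳ b = positive⇒natural positive-b+1
    from-b (suc zero)    rec rewrite ℕ.+-comm b 1    = positive⇒natural positive-b+2
    from-b (suc (suc j)) rec rewrite ℕ.+-suc b (suc j) | ℕ.+-suc b j =
      let (n , eq) = natural-+ (natural-* b (rec (s≤s (s≤s (s≤s (ℕ.m≤n+m j b))))))
                               (natural-* (suc b) (rec (s≤s (s≤s (ℕ.≤-trans (ℕ.m≤n+m j b) (ℕ.n≤1+n _))))))
      in n , trans (X-next j) eq
    go : ∀ m → (∀ {i} → i < m → Natural (X i)) → Natural (X m)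
    go zero    rec = 1 , sym (+-identityʳ 1#)
    go (suc m) rec with m ℕ.<? b
    ... | yes m<b = 0 , X-low m<b
    ... | no  m≮b = ≡.subst (λ m → (∀ {i} → i < suc m → Natural (X i)) → Natural (X (suc m)))
                      (ℕ.m+[n∸m]≡n (ℕ.≮⇒≥ m≮b)) (from-b (m ∸ b)) rec

  positive-step : ∀ j → Positive (X (2 ℕ.+ j)) ⊎ Positive (X (suc j)) → Positive (X (3 ℕ.+ (b ℕ.+ j)))
  positive-step j (inj₁ pos) = positive-resp (X-next j)
    (positive-+ (positive-* b 0<b pos) (natural-* (suc b) (natural-X (suc j))))
  positive-step j (inj₂ pos) = positive-resp (trans (X-next j) (+-comm (ν b * X (2 ℕ.+ j)) (ν (suc b) * X (suc j))))
    (positive-+ (positive-* (suc b) (s≤s z≤n) pos) (natural-* b (natural-X (2 ℕ.+ j))))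

  -- The index is a sum of q + 1 parts, r of them equal to b + 2 and the others to b + 1. The
  -- recurrence removes one part: a part b + 1 if there is one, otherwise a part b + 2.
  positive-X : ∀ q r → r ℕ.≤ suc q → Positive (X (suc q ℕ.* suc b ℕ.+ r))
  positive-X zero zero          _ =
    ≡.subst (Positive ∘ X) (≡.sym (≡.trans (ℕ.+-identityʳ (suc b ℕ.+ 0)) (ℕ.+-identityʳ (suc b)))) positive-b+1
  positive-X zero (suc zero)    _ =
    ≡.subst (Positive ∘ X) (≡.sym
      (≡.trans (ℕ.+-comm (suc b ℕ.+ 0) 1) (≡.cong suc (ℕ.+-identityʳ (suc b))))) positive-b+2
  positive-X zero (suc (suc r)) (s≤s ())
  positive-X (suc q) r r≤2+q with ℕ.m≤n⇒m<n∨m≡n r≤2+q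
  ... | inj₁ (s≤s r≤1+q) = ≡.subst (Positive ∘ X) index
    (positive-step j (inj₁ (≡.subst (Positive ∘ X) previous (positive-X q r r≤1+q))))
    where
    -- The smaller path must have the form `X (2 ℕ.+ j)`; the second unit is borrowed from `b`,
    -- which is positive.
    j = b ∸ 1 ℕ.+ q ℕ.* suc b ℕ.+ r
    b≡ : suc (b ∸ 1) ≡ b
    b≡ = ℕ.m+[n∸m]≡n 0<b
    previous : suc q ℕ.* suc b ℕ.+ r ≡ 2 ℕ.+ j
    previous = ≡.cong (λ n → suc (n ℕ.+ q ℕ.* suc b ℕ.+ r)) (≡.sym b≡)
    index : 3 ℕ.+ (b ℕ.+ j) ≡ suc (suc q) ℕ.* suc b ℕ.+ r
    index = ≡.trans (+-*-Solver.solve 2 (λ b j → conᴺ 3 :+ᴺ (b :+ᴺ j) :=ᴺ (conᴺ 1 :+ᴺ b) :+ᴺ (conᴺ 2 :+ᴺ j)) ≡.refl b j)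
      (≡.trans (≡.cong (suc b ℕ.+_) (≡.sym previous)) (≡.sym (ℕ.+-assoc (suc b) (suc q ℕ.* suc b) r)))
      where open +-*-Solver using () renaming (con to conᴺ; _:+_ to _:+ᴺ_; _:=_ to _:=ᴺ_)
  ... | inj₂ ≡.refl = ≡.subst (Positive ∘ X) index
    (positive-step j (inj₂ (≡.subst (Positive ∘ X) previous (positive-X q (suc q) ℕ.≤-refl))))
    where
    j = b ℕ.+ q ℕ.* suc b ℕ.+ suc q
    previous : suc q ℕ.* suc b ℕ.+ suc q ≡ suc j
    previous = ≡.refl
    index : 3 ℕ.+ (b ℕ.+ j) ≡ suc (suc q) ℕ.* suc b ℕ.+ suc (suc q)
    index = +-*-Solver.solve 2 (λ b q → conᴺ 3 :+ᴺ (b :+ᴺ (b :+ᴺ q :*ᴺ (conᴺ 1 :+ᴺ b) :+ᴺ (conᴺ 1 :+ᴺ q)))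
              :=ᴺ (conᴺ 2 :+ᴺ q) :*ᴺ (conᴺ 1 :+ᴺ b) :+ᴺ (conᴺ 2 :+ᴺ q)) ≡.refl b q
      where open +-*-Solver using () renaming (con to conᴺ; _:+_ to _:+ᴺ_; _:*_ to _:*ᴺ_; _:=_ to _:=ᴺ_)

  -- S(a,b,2) evaluates to -(X (a+1) + X (a+2)).
  not-positive : ¬ Positive (X (suc a) + X (2 ℕ.+ a))
  not-positive (n , pos) =
    let (s , s≥0 , eq) = spider-ab2≥0 nonNeg-1 {a} {b} 2≤b e-pos in
    contradiction (1-cancel-≤ (suc n) 0 s≥0 (ι.injective (vanishing eq))) λ ()
    where
    open Algebra.Properties.Semiring.Mult (CommutativeRing.semiring dual-ring) using () renaming (_×_ to _×ᴰ_)
    vanishing : ∀ {s} → ι s + (X (suc a) * X (2 ℕ.+ b) + X (2 ℕ.+ a) * X (suc b)) ≈ X (3 ℕ.+ (a ℕ.+ b)) →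
      ι (s +ᴰ (suc n ×ᴰ (1ℚ , 0ℚ))) ≈ ι (0ℚ , 0ℚ)
    vanishing {s} eq = begin
      ι (s +ᴰ (suc n ×ᴰ (1ℚ , 0ℚ))) ≈⟨ ι.+-homo _ _ ⟩
      ι s + ι (suc n ×ᴰ (1ℚ , 0ℚ))    ≈⟨ +-congˡ (trans (ι-ν (suc n)) (sym pos)) ⟩
      ι s + (X (suc a) + X (2 ℕ.+ a)) ≈⟨ cancelled ⟩
      0#                              ≈⟨ sym ι.0#-homo ⟩
      ι (0ℚ , 0ℚ)                     ∎
      where
      cancelled : ι s + (X (suc a) + X (2 ℕ.+ a)) ≈ 0#
      -- The cancelled term is the recurrence for X_n; the products have coefficients b + 1 and b +
      -- 2 where it has b and b + 1.
      cancelled = +-cancelʳ (ν b * X (2 ℕ.+ a) + ν (suc b) * X (suc a)) _ _ (begin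
        (ι s + (X (suc a) + X (2 ℕ.+ a))) + (ν b * X (2 ℕ.+ a) + ν (suc b) * X (suc a))
          ≈⟨ solve 4 (λ s b t u → (s :+ (t :+ u)) :+ (b :* u :+ (con 1 :+ b) :* t)
               := s :+ (t :* (con 1 :+ (con 1 :+ b)) :+ u :* (con 1 :+ b))) refl (ι s) (ν b) _ _ ⟩
        ι s + (X (suc a) * ν (2 ℕ.+ b) + X (2 ℕ.+ a) * ν (suc b))
          ≈⟨ +-congˡ (+-cong (*-congˡ (sym (Positive.equals positive-b+2))) (*-congˡ (sym X-d+1))) ⟩
        ι s + (X (suc a) * X (2 ℕ.+ b) + X (2 ℕ.+ a) * X (suc b))
          ≈⟨ eq ⟩
        X (3 ℕ.+ (a ℕ.+ b))
          ≈⟨ trans (reflexive (≡.cong (λ n → X (3 ℕ.+ n)) (ℕ.+-comm a b))) (X-next a) ⟩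
        ν b * X (2 ℕ.+ a) + ν (suc b) * X (suc a)
          ≈⟨ sym (+-identityˡ _) ⟩
        0# + (ν b * X (2 ℕ.+ a) + ν (suc b) * X (suc a)) ∎)

  -- Write a + 2 = (q + 1)(b + 1) + r with r ≤ b; the quotient is positive because a ≥ b. If r ≤ q +
  -- 1, then X_{a+2} is positive; if r = q + 2, then X_{a+1} is. Hence r ≥ q + 3, so q + 1 ≤ r - 2 ≤
  -- b - 2, and a = (q + 1)(b + 1) + (r - 2) satisfies both bounds for the witness q + 1.
  quotient-bounds : b ℕ.≤ a →
    ∃[ q ] (1 ℕ.≤ q × q ℕ.≤ b ∸ 2 × (b ℕ.+ 2) ℕ.* q ℕ.≤ a × a ℕ.≤ (b ℕ.+ 1) ℕ.* q ℕ.+ (b ∸ 2))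
  quotient-bounds b≤a
    with (2 ℕ.+ a) % suc b | (2 ℕ.+ a) / suc b | m≡m%n+[m/n]*n (2 ℕ.+ a) (suc b) | m%n<n (2 ℕ.+ a) (suc b)
  ... | r | zero  | division | r<1+b = contradiction
    (ℕ.≤-trans (ℕ.≤-reflexive (≡.trans division (ℕ.+-identityʳ r))) (ℕ.≤-pred r<1+b))
    (ℕ.<⇒≱ (s≤s (ℕ.≤-trans b≤a (ℕ.n≤1+n a))))
  ... | r | suc q | division | s≤s r≤b = suc q , s≤s z≤n , ℕ.≤-trans q+2≤r (ℕ.∸-monoˡ-≤ 2 r≤b) , lower , upper
    where
    open +-*-Solver using () renaming (con to conᴺ; solve to solveᴺ; _:+_ to _:+ᴺ_; _:*_ to _:*ᴺ_; _:=_ to _:=ᴺ_)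
    2+a≡ : 2 ℕ.+ a ≡ suc q ℕ.* suc b ℕ.+ r
    2+a≡ = ≡.trans division (ℕ.+-comm r _)
    r≰1+q : ¬ r ℕ.≤ suc q
    r≰1+q r≤1+q = not-positive (positive-resp (+-comm (X (suc a)) (X (2 ℕ.+ a)))
      (positive-+ (≡.subst (Positive ∘ X) (≡.sym 2+a≡) (positive-X q r r≤1+q)) (natural-X (suc a))))
    r≢2+q : r ≢ 2 ℕ.+ q
    r≢2+q ≡.refl = not-positive
      (positive-+ (≡.subst (Positive ∘ X) (≡.sym 1+a≡) (positive-X q (suc q) ℕ.≤-refl)) (natural-X (2 ℕ.+ a)))
      where
      1+a≡ : suc a ≡ suc q ℕ.* suc b ℕ.+ suc q
      1+a≡ = ℕ.suc-injective (≡.trans 2+a≡ (ℕ.+-suc (suc q ℕ.* suc b) (suc q)))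
    3+q≤r : 3 ℕ.+ q ℕ.≤ r
    3+q≤r = ℕ.≤∧≢⇒< (ℕ.≰⇒> r≰1+q) (r≢2+q ∘ ≡.sym)
    q+2≤r : suc q ℕ.≤ r ∸ 2
    q+2≤r = ℕ.∸-monoˡ-≤ 2 3+q≤r
    a≡ : a ≡ suc q ℕ.* suc b ℕ.+ (r ∸ 2)
    a≡ = ℕ.+-cancelˡ-≡ 2 _ _ (≡.trans 2+a≡ (≡.trans
      (≡.cong (suc q ℕ.* suc b ℕ.+_) (≡.sym (ℕ.m+[n∸m]≡n (ℕ.≤-trans (s≤s (s≤s z≤n)) 3+q≤r))))
      (solveᴺ 2 (λ m n → m :+ᴺ (conᴺ 2 :+ᴺ n) :=ᴺ conᴺ 2 :+ᴺ (m :+ᴺ n)) ≡.refl (suc q ℕ.* suc b) (r ∸ 2))))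
    lower : (b ℕ.+ 2) ℕ.* suc q ℕ.≤ a
    lower = ℕ.≤-trans
      (ℕ.≤-reflexive (solveᴺ 2 (λ b q → (b :+ᴺ conᴺ 2) :*ᴺ q :=ᴺ q :*ᴺ (conᴺ 1 :+ᴺ b) :+ᴺ q) ≡.refl b (suc q)))
      (ℕ.≤-trans (ℕ.+-monoʳ-≤ (suc q ℕ.* suc b) q+2≤r) (ℕ.≤-reflexive (≡.sym a≡)))
    upper : a ℕ.≤ (b ℕ.+ 1) ℕ.* suc q ℕ.+ (b ∸ 2)
    upper = ℕ.≤-trans (ℕ.≤-reflexive a≡) (ℕ.≤-trans
      (ℕ.+-monoʳ-≤ (suc q ℕ.* suc b) (ℕ.∸-monoˡ-≤ 2 r≤b))
      (ℕ.≤-reflexive (solveᴺ 3 (λ b q c → q :*ᴺ (conᴺ 1 :+ᴺ b) :+ᴺ c :=ᴺ (b :+ᴺ conᴺ 1) :*ᴺ q :+ᴺ c) ≡.refl b (suc q) (b ∸ 2))))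

-- The bound a ≤ 2b + 4, from e_3 = 1 and e_4 = ε

-- With e₃ = 1 and e₄ = ε, the path with 3m + 4 vertices has the value u m · ε.
u : ℕ → ℕ
u zero    = 4
u (suc m) = 2 ℕ.* u m ℕ.+ 9 ℕ.* 2 ^ m

-- The closed form u m = 2^m (4 + 9 m / 2), doubled to stay among the integers.
2u≡ : ∀ m → 2 ℕ.* u m ≡ 2 ^ m ℕ.* (9 ℕ.* m ℕ.+ 8)
2u≡ zero    = ≡.refl
2u≡ (suc m) = ≡.trans
  (solve 2 (λ u p → con 2 :* (con 2 :* u :+ con 9 :* p) := con 2 :* (con 2 :* u) :+ con 18 :* p) ≡.refl (u m) (2 ^ m))
  (≡.trans (≡.cong (λ v → 2 ℕ.* v ℕ.+ 18 ℕ.* 2 ^ m) (2u≡ m))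
    (solve 2 (λ m p → con 2 :* (p :* (con 9 :* m :+ con 8)) :+ con 18 :* p
                := con 2 :* p :* (con 9 :* (con 1 :+ m) :+ con 8)) ≡.refl m (2 ^ m)))
  where open +-*-Solver

-- After doubling and division by 2^(k+l) the hypothesis reads 9 k ≤ 18 l + 10.
u-bound : ∀ k l → u k ℕ.* (3 ℕ.* 2 ^ l) ℕ.≤ u (suc (k ℕ.+ l)) → k ℕ.≤ suc (2 ℕ.* l)
u-bound k l u≤u = ℕ.≮⇒≥ λ 1+2l<k → ℕ.<⇒≱ (too-large 1+2l<k) bound
  where
  open +-*-Solver
  bound : 3 ℕ.* (9 ℕ.* k ℕ.+ 8) ℕ.≤ 2 ℕ.* (9 ℕ.* suc (k ℕ.+ l) ℕ.+ 8)
  bound = ℕ.*-cancelˡ-≤ (2 ^ k ℕ.* 2 ^ l) {{ℕ.m*n≢0 (2 ^ k) (2 ^ l) {{ℕ.m^n≢0 2 k}} {{ℕ.m^n≢0 2 l}}}} (begin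
    2 ^ k ℕ.* 2 ^ l ℕ.* (3 ℕ.* (9 ℕ.* k ℕ.+ 8))
      ≡⟨ solve 3 (λ p q v → p :* q :* (con 3 :* v) := p :* v :* (con 3 :* q)) ≡.refl (2 ^ k) (2 ^ l) (9 ℕ.* k ℕ.+ 8) ⟩
    2 ^ k ℕ.* (9 ℕ.* k ℕ.+ 8) ℕ.* (3 ℕ.* 2 ^ l)
      ≡⟨ ≡.cong (ℕ._* (3 ℕ.* 2 ^ l)) (≡.sym (2u≡ k)) ⟩
    2 ℕ.* u k ℕ.* (3 ℕ.* 2 ^ l)
      ≡⟨ ℕ.*-assoc 2 (u k) _ ⟩
    2 ℕ.* (u k ℕ.* (3 ℕ.* 2 ^ l))
      ≤⟨ ℕ.*-monoʳ-≤ 2 u≤u ⟩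
    2 ℕ.* u (suc (k ℕ.+ l))
      ≡⟨ 2u≡ (suc (k ℕ.+ l)) ⟩
    2 ℕ.* 2 ^ (k ℕ.+ l) ℕ.* (9 ℕ.* suc (k ℕ.+ l) ℕ.+ 8)
      ≡⟨ ≡.cong (λ p → 2 ℕ.* p ℕ.* (9 ℕ.* suc (k ℕ.+ l) ℕ.+ 8)) (ℕ.^-distribˡ-+-* 2 k l) ⟩
    2 ℕ.* (2 ^ k ℕ.* 2 ^ l) ℕ.* (9 ℕ.* suc (k ℕ.+ l) ℕ.+ 8)
      ≡⟨ solve 2 (λ p v → con 2 :* p :* v := p :* (con 2 :* v)) ≡.refl (2 ^ k ℕ.* 2 ^ l) (9 ℕ.* suc (k ℕ.+ l) ℕ.+ 8) ⟩
    2 ^ k ℕ.* 2 ^ l ℕ.* (2 ℕ.* (9 ℕ.* suc (k ℕ.+ l) ℕ.+ 8)) ∎)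
    where open ℕ.≤-Reasoning
  too-large : suc (2 ℕ.* l) < k → 2 ℕ.* (9 ℕ.* suc (k ℕ.+ l) ℕ.+ 8) < 3 ℕ.* (9 ℕ.* k ℕ.+ 8)
  too-large 1+2l<k = begin
    suc (2 ℕ.* (9 ℕ.* suc (k ℕ.+ l) ℕ.+ 8))
      -- If k ≥ 2 l + 2, then 9 k exceeds 18 l + 10 by at least 8: one for strictness and a slack of
      -- 7.
      ≤⟨ ℕ.m≤m+n _ 7 ⟩
    suc (2 ℕ.* (9 ℕ.* suc (k ℕ.+ l) ℕ.+ 8)) ℕ.+ 7
      ≡⟨ solve 2 (λ k l → con 1 :+ con 2 :* (con 9 :* (con 1 :+ (k :+ l)) :+ con 8) :+ con 7
                    := con 18 :* k :+ con 24 :+ con 9 :* (con 2 :+ con 2 :* l)) ≡.refl k l ⟩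
    18 ℕ.* k ℕ.+ 24 ℕ.+ 9 ℕ.* (2 ℕ.+ 2 ℕ.* l)
      ≤⟨ ℕ.+-monoʳ-≤ (18 ℕ.* k ℕ.+ 24) (ℕ.*-monoʳ-≤ 9 1+2l<k) ⟩
    18 ℕ.* k ℕ.+ 24 ℕ.+ 9 ℕ.* k
      ≡⟨ solve 1 (λ k → con 18 :* k :+ con 24 :+ con 9 :* k := con 3 :* (con 9 :* k :+ con 8)) ≡.refl k ⟩
    3 ℕ.* (9 ℕ.* k ℕ.+ 8) ∎
    where open ℕ.≤-Reasoning

module _ (E : Extension dual-ring) (x : Fin 4 → Ring₀.Carrier (Extension.ring E))
  (elem-x : ∀ k → Ring₀._≈_ (Extension.ring E) (Elementary.elem (Extension.ring E) x k)
                                (Extension.ι E (Coefficients.trinomial dual-ring 2 ε k))) where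
  open Valuation 2 ε E x elem-x
  open SetoidReasoning setoid
  open NatSolver commutativeSemiring using (solve; _:+_; _:*_; _:=_; con)

  η : Carrier
  η = ι ε

  η²≈0 : η * η ≈ 0#
  η²≈0 = trans (sym (ι.*-homo ε ε)) ι.0#-homo

  -- The recurrence joins an index to those smaller by 3 and, with a factor ε, by 4, so the residues
  -- modulo 3 close up. `X₁` records only annihilation by ε: the value is 0 for m = 0 and a multiple
  -- of ε afterwards, and the recurrence for `X₂` uses it only times ε.
  record Values (m : ℕ) : Set where
    field
      X₁ : X (1 ℕ.+ m ℕ.* 3) * η ≈ 0#
      X₂ : X (2 ℕ.+ m ℕ.* 3) ≈ 0#
      X₃ : X (3 ℕ.+ m ℕ.* 3) ≈ ν (3 ℕ.* 2 ^ m)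
      X₄ : X (4 ℕ.+ m ℕ.* 3) ≈ ν (u m) * η

  values : ∀ m → Values m
  values zero = record
    { X₁ = trans (*-congʳ (X-low (s≤s z≤n))) (zeroˡ _)
    ; X₂ = X-low (s≤s (s≤s z≤n))
    ; X₃ = X-d+1
    ; X₄ = X-d+2 (s≤s z≤n)
    }
  values (suc m) = record
    { X₁ = trans (*-congʳ X₄) (trans (*-assoc _ _ _) (trans (*-congˡ η²≈0) (zeroʳ _)))
    ; X₂ = begin
        X (5 ℕ.+ m ℕ.* 3)
          ≈⟨ X-d+3 (m ℕ.* 3) ⟩
        ν 2 * X (2 ℕ.+ m ℕ.* 3) + ν 3 * η * X (1 ℕ.+ m ℕ.* 3)
          ≈⟨ +-cong (*-congˡ X₂) (trans (*-assoc _ _ _) (*-congˡ (trans (*-comm _ _) X₁))) ⟩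
        ν 2 * 0# + ν 3 * 0#
          ≈⟨ trans (+-cong (zeroʳ _) (zeroʳ _)) (+-identityˡ _) ⟩
        0# ∎
    ; X₃ = begin
        X (6 ℕ.+ m ℕ.* 3)
          ≈⟨ X-d+3 (1 ℕ.+ m ℕ.* 3) ⟩
        ν 2 * X (3 ℕ.+ m ℕ.* 3) + ν 3 * η * X (2 ℕ.+ m ℕ.* 3)
          ≈⟨ +-cong (*-congˡ X₃) (*-congˡ X₂) ⟩
        ν 2 * ν (3 ℕ.* 2 ^ m) + ν 3 * η * 0#
          ≈⟨ trans (+-congˡ (zeroʳ _)) (+-identityʳ _) ⟩
        ν 2 * ν (3 ℕ.* 2 ^ m)
          ≈⟨ sym (×1-homo-* 2 (3 ℕ.* 2 ^ m)) ⟩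
        ν (2 ℕ.* (3 ℕ.* 2 ^ m))
          ≡⟨ ≡.cong ν (+-*-Solver.solve 1 (λ p → conᴺ 2 :*ᴺ (conᴺ 3 :*ᴺ p) :=ᴺ conᴺ 3 :*ᴺ (conᴺ 2 :*ᴺ p)) ≡.refl (2 ^ m)) ⟩
        ν (3 ℕ.* 2 ^ suc m) ∎
    ; X₄ = begin
        X (7 ℕ.+ m ℕ.* 3)
          ≈⟨ X-d+3 (2 ℕ.+ m ℕ.* 3) ⟩
        ν 2 * X (4 ℕ.+ m ℕ.* 3) + ν 3 * η * X (3 ℕ.+ m ℕ.* 3)
          ≈⟨ +-cong (*-congˡ X₄) (*-congˡ X₃) ⟩
        ν 2 * (ν (u m) * η) + ν 3 * η * ν (3 ℕ.* 2 ^ m)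
          ≈⟨ solve 5 (λ a b c d e → a :* (b :* e) :+ c :* e :* d := (a :* b :+ c :* d) :* e) refl
               (ν 2) (ν (u m)) (ν 3) (ν (3 ℕ.* 2 ^ m)) η ⟩
        (ν 2 * ν (u m) + ν 3 * ν (3 ℕ.* 2 ^ m)) * η
          ≈⟨ *-congʳ (+-cong (sym (×1-homo-* 2 (u m))) (sym (×1-homo-* 3 (3 ℕ.* 2 ^ m)))) ⟩
        (ν (2 ℕ.* u m) + ν (3 ℕ.* (3 ℕ.* 2 ^ m))) * η
          ≈⟨ *-congʳ (sym (×-homo-+ 1# (2 ℕ.* u m) (3 ℕ.* (3 ℕ.* 2 ^ m)))) ⟩
        ν (2 ℕ.* u m ℕ.+ 3 ℕ.* (3 ℕ.* 2 ^ m)) * η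
          ≡⟨ ≡.cong (λ n → ν (2 ℕ.* u m ℕ.+ n) * η) (≡.sym (ℕ.*-assoc 3 3 (2 ^ m))) ⟩
        ν (u (suc m)) * η ∎
    }
    where
    open Values (values m)
    open +-*-Solver using () renaming (con to conᴺ; _:*_ to _:*ᴺ_; _:=_ to _:=ᴺ_)

  -- The path with n = 3(k + l + 1) + 4 vertices has the value u (k + l + 1) ε, the product X_{a+1}
  -- X_{b+2} is u k ε · 3 · 2^l, and X_{b+1} = 0 removes the other product. The inequality compares
  -- the coefficients of ε.
  multiple-of-3-bound : ∀ k l → IsEPositive (spider (suc k ℕ.* 3 ∷ suc (l ℕ.* 3) ∷ 2 ∷ [])) →
    u k ℕ.* (3 ℕ.* 2 ^ l) ℕ.≤ u (suc (k ℕ.+ l))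
  multiple-of-3-bound k l e-pos =
    let (s , s≥0 , eq) = spider-ab2≥0 nonNeg-ε {suc k ℕ.* 3} {suc (l ℕ.* 3)} ℕ.≤-refl e-pos in
    ε-cancel-≤ (u k ℕ.* (3 ℕ.* 2 ^ l)) (u (suc (k ℕ.+ l))) s≥0 (ι.injective (value eq))
    where
    open Algebra.Properties.Semiring.Mult (CommutativeRing.semiring dual-ring) using () renaming (_×_ to _×ᴰ_)
    open +-*-Solver using () renaming (con to conᴺ; _:+_ to _:+ᴺ_; _:*_ to _:*ᴺ_; _:=_ to _:=ᴺ_)
    1ᴰ : Dual
    1ᴰ = 1ℚ , 0ℚ
    index : 3 ℕ.+ (suc k ℕ.* 3 ℕ.+ suc (l ℕ.* 3)) ≡ 4 ℕ.+ suc (k ℕ.+ l) ℕ.* 3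
    index = +-*-Solver.solve 2 (λ k l → conᴺ 3 :+ᴺ ((conᴺ 1 :+ᴺ k) :*ᴺ conᴺ 3 :+ᴺ (conᴺ 1 :+ᴺ l :*ᴺ conᴺ 3))
              :=ᴺ conᴺ 4 :+ᴺ (conᴺ 1 :+ᴺ (k :+ᴺ l)) :*ᴺ conᴺ 3) ≡.refl k l
    value : ∀ {s} →
      ι s + (X (4 ℕ.+ k ℕ.* 3) * X (3 ℕ.+ l ℕ.* 3) + X (5 ℕ.+ k ℕ.* 3) * X (2 ℕ.+ l ℕ.* 3))
        ≈ X (3 ℕ.+ (suc k ℕ.* 3 ℕ.+ suc (l ℕ.* 3))) →
      ι (s +ᴰ ((u k ℕ.* (3 ℕ.* 2 ^ l)) ×ᴰ 1ᴰ) *ᴰ ε) ≈ ι ((u (suc (k ℕ.+ l)) ×ᴰ 1ᴰ) *ᴰ ε)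
    value {s} eq = begin
      ι (s +ᴰ ((u k ℕ.* (3 ℕ.* 2 ^ l)) ×ᴰ 1ᴰ) *ᴰ ε)
        ≈⟨ trans (ι.+-homo _ _) (+-congˡ (ι.*-homo _ ε)) ⟩
      ι s + ι ((u k ℕ.* (3 ℕ.* 2 ^ l)) ×ᴰ 1ᴰ) * η
        ≈⟨ +-congˡ (*-congʳ (trans (ι-ν (u k ℕ.* (3 ℕ.* 2 ^ l))) (×1-homo-* (u k) (3 ℕ.* 2 ^ l)))) ⟩
      ι s + ν (u k) * ν (3 ℕ.* 2 ^ l) * η
        ≈⟨ +-congˡ (solve 4 (λ a b e y → a :* b :* e := a :* e :* b :+ y :* con 0) refl
             (ν (u k)) (ν (3 ℕ.* 2 ^ l)) η (X (5 ℕ.+ k ℕ.* 3))) ⟩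
      ι s + (ν (u k) * η * ν (3 ℕ.* 2 ^ l) + X (5 ℕ.+ k ℕ.* 3) * 0#)
        ≈⟨ +-congˡ (+-cong (*-cong (sym (Values.X₄ (values k))) (sym (Values.X₃ (values l))))
             (*-congˡ (sym (Values.X₂ (values l))))) ⟩
      ι s + (X (4 ℕ.+ k ℕ.* 3) * X (3 ℕ.+ l ℕ.* 3) + X (5 ℕ.+ k ℕ.* 3) * X (2 ℕ.+ l ℕ.* 3))
        ≈⟨ eq ⟩
      X (3 ℕ.+ (suc k ℕ.* 3 ℕ.+ suc (l ℕ.* 3)))
        ≡⟨ ≡.cong X index ⟩
      X (4 ℕ.+ suc (k ℕ.+ l) ℕ.* 3)
        ≈⟨ Values.X₄ (values (suc (k ℕ.+ l))) ⟩
      ν (u (suc (k ℕ.+ l))) * η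
        ≈⟨ sym (trans (ι.*-homo _ ε) (*-congʳ (ι-ν (u (suc (k ℕ.+ l)))))) ⟩
      ι ((u (suc (k ℕ.+ l)) ×ᴰ 1ᴰ) *ᴰ ε) ∎

open import Data.Nat using (_+_; _*_; _≤_)

3k+3≤6l+6 : ∀ k l → k ≤ suc (2 * l) → suc k * 3 ≤ 2 * suc (l * 3) + 4
3k+3≤6l+6 k l k≤ = ℕ.≤-trans (ℕ.*-monoˡ-≤ 3 (s≤s k≤))
  (ℕ.≤-reflexive (solve 1 (λ l → (con 2 :+ con 2 :* l) :* con 3 := con 2 :* (con 1 :+ l :* con 3) :+ con 4) ≡.refl l))
  where open +-*-Solver

theorem4p3 : (a b : ℕ) → 2 ≤ b → b ≤ a →
    IsEPositive (spider (a ∷ b ∷ 2 ∷ [])) →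
    (∃[ q ] (1 ≤ q × q ≤ b ∸ 2 × (b + 2) * q ≤ a × a ≤ (b + 1) * q + (b ∸ 2)))
    × (a % 3 ≡ 0 → b % 3 ≡ 1 → a ≤ 2 * b + 4)
theorem4p3 a b 2≤b b≤a e-pos =
  (let (E , x , elem-x) = trinomial-valuation b (1ℚ , 0ℚ) in quotient-bounds a b 2≤b e-pos E x elem-x b≤a) ,
  λ a%3≡0 b%3≡1 → bound (a / 3) (b / 3) (division a a%3≡0) (division b b%3≡1) e-pos
  where
  division : ∀ n {r} → n % 3 ≡ r → n ≡ r + n / 3 * 3
  division n ≡.refl = m≡m%n+[m/n]*n n 3
  bound : ∀ {a b} k l → a ≡ k * 3 → b ≡ suc (l * 3) → IsEPositive (spider (a ∷ b ∷ 2 ∷ [])) → a ≤ 2 * b + 4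
  bound zero    l ≡.refl ≡.refl _     = z≤n
  bound (suc k) l ≡.refl ≡.refl e-pos = 3k+3≤6l+6 k l (u-bound k l
    (let (E , x , elem-x) = trinomial-valuation 2 ε in multiple-of-3-bound E x elem-x k l e-pos))
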